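{- For every $\varepsilon>0$ and every real $\rho>1$ there exist an integer $n$, a finite set $W\subset\{1,\rho,\rho^2,\dots\}$, and a probability distribution $D$ over the $n$-element subsets of $W$ such that, if an instance of the single secretary problem is drawn from $D$, every randomized algorithm (which may know $D$) accepts the maximum element of the instance with probability at most $\frac1e+\varepsilon$, the probability being over the choice of the instance, the uniformly random arrival order, and the algorithm's randomness.
   Context: Single secretary problem with $n$ items: an instance is a set of $n$ pairwise distinct positive reals presented one at a time in uniformly random order; the algorithm must irrevocably accept or reject each element upon arrival and may accept at most one. A randomized algorithm is given by probabilities $a_i(v_1,\dots,v_i)\in[0,1]$ of stopping and accepting $v_i$ at time $i$ given the sequence seen so far and not having stopped earlier. -}

module Defs where

open import Data.Bool.Base using (if_then_else_)
open import Data.Integer.Base as ℤ using (+_; +[1+_])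
open import Data.List.Base using (List; []; _∷_; _++_; [_]; map; concatMap; foldr; _∷ʳ_)
open import Data.List.Membership.Propositional using (_∈_)
open import Data.List.Relation.Binary.Pointwise.Base using (Pointwise)
open import Data.List.Relation.Unary.All using (all?)
open import Data.List.Relation.Unary.Unique.Propositional using (Unique)
open import Data.Nat.Base as ℕ using (ℕ; zero; suc; _!)
import Data.Nat.Properties as ℕₚ
open import Data.Product.Base using (∃; _×_; _,_; proj₁; proj₂)
open import Data.Rational.Base as ℚ using (ℚ; 0ℚ; 1ℚ; ½; mkℚ; toℚᵘ; ∣_∣; Positive; NonNegative; positive; nonNegative; *<*)
open import Data.Rational.Properties as ℚₚ using (module ≤-Reasoning)
open import Data.Rational.Solver using (module +-*-Solver)
import Data.Rational.Unnormalised.Base as ℚᵘ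
import Data.Rational.Unnormalised.Properties as ℚᵘₚ
open import Data.Sum.Base using (inj₁; inj₂)
open import Relation.Binary.PropositionalEquality using (_≡_; refl; sym; trans; cong; cong₂; subst)
open import Relation.Nullary.Decidable using (⌊_⌋)

------------------------------------------------------------------------
-- Real numbers: Cauchy sequences of rationals, taken up to _≈_.

IsCauchy : (ℕ → ℚ) → Set
IsCauchy f = ∀ ε → 0ℚ ℚ.< ε →
  ∃ λ N → ∀ m n → N ℕ.≤ m → N ℕ.≤ n → ∣ f m ℚ.- f n ∣ ℚ.< ε

record ℝ : Set where
  constructor mkℝ
  field
    seq    : ℕ → ℚ
    cauchy : IsCauchy seq

open ℝ public

infix 4 _≈_ _≤_ _<_

-- Records rather than plain definitions, so that x and y can be inferred.

record _≈_ (x y : ℝ) : Set where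
  constructor mk≈
  field
    ∣x-y∣<ε : ∀ ε → 0ℚ ℚ.< ε →
      ∃ λ N → ∀ n → N ℕ.≤ n → ∣ seq x n ℚ.- seq y n ∣ ℚ.< ε

record _≤_ (x y : ℝ) : Set where
  constructor mk≤
  field
    x≤y+ε : ∀ ε → 0ℚ ℚ.< ε →
      ∃ λ N → ∀ n → N ℕ.≤ n → seq x n ℚ.≤ seq y n ℚ.+ ε

record _<_ (x y : ℝ) : Set where
  constructor mk<
  field
    gap     : ℚ
    gap>0   : 0ℚ ℚ.< gap
    x+gap≤y : ∃ λ N → ∀ n → N ℕ.≤ n → seq x n ℚ.+ gap ℚ.≤ seq y n

open _≈_ public
open _≤_ public
open _<_ public

open +-*-Solver

module ArithmeticLemmas where
  abstract
    ½>0 : ∀ {ε} → 0ℚ ℚ.< ε → 0ℚ ℚ.< ½ ℚ.* ε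
    ½>0 {ε} ε>0 = ℚₚ.positive⁻¹ (½ ℚ.* ε) {{ℚₚ.pos*pos⇒pos ½ ε {{positive ε>0}}}}

    ½+½ : ∀ ε → ½ ℚ.* ε ℚ.+ ½ ℚ.* ε ≡ ε
    ½+½ ε = trans (sym (ℚₚ.*-distribʳ-+ ε ½ ½)) (ℚₚ.*-identityˡ ε)

    ∣x-x∣≡0 : ∀ x → ∣ x ℚ.- x ∣ ≡ 0ℚ
    ∣x-x∣≡0 x = cong ∣_∣ (ℚₚ.+-inverseʳ x)

    ∣∣-sym : ∀ x y → ∣ x ℚ.- y ∣ ≡ ∣ y ℚ.- x ∣
    ∣∣-sym x y = trans (sym (ℚₚ.∣-p∣≡∣p∣ (x ℚ.- y)))
      (cong ∣_∣ (solve 2 (λ a b → :- (a :- b) := b :- a) refl x y))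

    -- Two points of an interval are no further apart than its endpoints.
    interval : ∀ {a b x y} → a ℚ.≤ x → x ℚ.≤ b → a ℚ.≤ y → y ℚ.≤ b → ∣ x ℚ.- y ∣ ℚ.≤ b ℚ.- a
    interval {a} {b} {x} {y} a≤x x≤b a≤y y≤b with ℚₚ.∣p∣≡p∨∣p∣≡-p (x ℚ.- y)
    ... | inj₁ eq = subst (ℚ._≤ b ℚ.- a) (sym eq) (ℚₚ.+-mono-≤ x≤b (ℚₚ.neg-antimono-≤ a≤y))
    ... | inj₂ eq = subst (ℚ._≤ b ℚ.- a)
      (sym (trans eq (solve 2 (λ u v → :- (u :- v) := v :- u) refl x y)))
      (ℚₚ.+-mono-≤ y≤b (ℚₚ.neg-antimono-≤ a≤x))

    const-cauchy : ∀ q → IsCauchy (λ _ → q)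
    const-cauchy q ε ε>0 = 0 , λ _ _ _ _ → subst (ℚ._< ε) (sym (∣x-x∣≡0 q)) ε>0

    +-cauchy : ∀ f g → IsCauchy f → IsCauchy g → IsCauchy (λ n → f n ℚ.+ g n)
    +-cauchy f g cf cg ε ε>0 with cf (½ ℚ.* ε) (½>0 ε>0) | cg (½ ℚ.* ε) (½>0 ε>0)
    ... | N , p | M , q = N ℕ.⊔ M , λ m n m≥ n≥ → begin-strict
      ∣ (f m ℚ.+ g m) ℚ.- (f n ℚ.+ g n) ∣
        ≡⟨ cong ∣_∣ (solve 4 (λ a b c d → (a :+ b) :- (c :+ d) := (a :- c) :+ (b :- d)) refl (f m) (g m) (f n) (g n)) ⟩
      ∣ (f m ℚ.- f n) ℚ.+ (g m ℚ.- g n) ∣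
        ≤⟨ ℚₚ.∣p+q∣≤∣p∣+∣q∣ (f m ℚ.- f n) (g m ℚ.- g n) ⟩
      ∣ f m ℚ.- f n ∣ ℚ.+ ∣ g m ℚ.- g n ∣
        <⟨ ℚₚ.+-mono-< (p m n (ℕₚ.m⊔n≤o⇒m≤o N M m≥) (ℕₚ.m⊔n≤o⇒m≤o N M n≥))
                       (q m n (ℕₚ.m⊔n≤o⇒n≤o N M m≥) (ℕₚ.m⊔n≤o⇒n≤o N M n≥)) ⟩
      ½ ℚ.* ε ℚ.+ ½ ℚ.* ε ≡⟨ ½+½ ε ⟩
      ε ∎
      where open ≤-Reasoning

    neg-cauchy : ∀ f → IsCauchy f → IsCauchy (λ n → ℚ.- f n)
    neg-cauchy f cf ε ε>0 with cf ε ε>0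
    ... | N , p = N , λ m n m≥ n≥ → subst (ℚ._< ε)
      (cong ∣_∣ (solve 2 (λ a b → b :- a := :- a :- (:- b)) refl (f m) (f n)))
      (p n m n≥ m≥)

    eventually-bounded : ∀ f → IsCauchy f →
      ∃ λ B → 0ℚ ℚ.< B × (∃ λ N → ∀ n → N ℕ.≤ n → ∣ f n ∣ ℚ.≤ B)
    eventually-bounded f cf with cf 1ℚ (ℚₚ.positive⁻¹ 1ℚ)
    ... | N , p = 1ℚ ℚ.+ ∣ f N ∣
                , ℚₚ.+-mono-<-≤ (ℚₚ.positive⁻¹ 1ℚ) (ℚₚ.0≤∣p∣ (f N))
                , N , λ n n≥ → begin
      ∣ f n ∣ ≡⟨ cong ∣_∣ (solve 2 (λ a b → a := (a :- b) :+ b) refl (f n) (f N)) ⟩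
      ∣ (f n ℚ.- f N) ℚ.+ f N ∣ ≤⟨ ℚₚ.∣p+q∣≤∣p∣+∣q∣ (f n ℚ.- f N) (f N) ⟩
      ∣ f n ℚ.- f N ∣ ℚ.+ ∣ f N ∣ ≤⟨ ℚₚ.+-monoˡ-≤ ∣ f N ∣ (ℚₚ.<⇒≤ (p n N n≥ ℕₚ.≤-refl)) ⟩
      1ℚ ℚ.+ ∣ f N ∣ ∎
      where open ≤-Reasoning

    ∣ab∣<Bδ : ∀ {a b B δ} → 0ℚ ℚ.< B → ∣ a ∣ ℚ.≤ B → ∣ b ∣ ℚ.< δ → ∣ a ℚ.* b ∣ ℚ.< B ℚ.* δ
    ∣ab∣<Bδ {a} {b} {B} {δ} B>0 a≤B b<δ = begin-strict
      ∣ a ℚ.* b ∣       ≡⟨ ℚₚ.∣p*q∣≡∣p∣*∣q∣ a b ⟩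
      ∣ a ∣ ℚ.* ∣ b ∣   ≤⟨ ℚₚ.*-monoʳ-≤-nonNeg ∣ b ∣ {{ℚₚ.∣-∣-nonNeg b}} a≤B ⟩
      B ℚ.* ∣ b ∣       <⟨ ℚₚ.*-monoʳ-<-pos B {{positive B>0}} b<δ ⟩
      B ℚ.* δ ∎
      where open ≤-Reasoning

    divide : ∀ {B ε} → 0ℚ ℚ.< B → 0ℚ ℚ.< ε → ∃ λ δ → 0ℚ ℚ.< δ × B ℚ.* δ ≡ ε
    divide {B} {ε} B>0 ε>0 = B⁻¹ ℚ.* ε
      , ℚₚ.positive⁻¹ (B⁻¹ ℚ.* ε) {{ℚₚ.pos*pos⇒pos B⁻¹ {{ℚₚ.1/pos⇒pos B {{positive B>0}}}} ε {{positive ε>0}}}}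
      , trans (sym (ℚₚ.*-assoc B B⁻¹ ε))
          (trans (cong (ℚ._* ε) (ℚₚ.*-inverseʳ B {{ℚₚ.pos⇒nonZero B {{positive B>0}}}})) (ℚₚ.*-identityˡ ε))
      where
      B⁻¹ : ℚ
      B⁻¹ = (ℚ.1/ B) {{ℚₚ.pos⇒nonZero B {{positive B>0}}}}

    product-difference : ∀ a b c d → a ℚ.* b ℚ.- c ℚ.* d ≡ a ℚ.* (b ℚ.- d) ℚ.+ d ℚ.* (a ℚ.- c)
    product-difference = solve 4 (λ x y z w → x :* y :- z :* w := x :* (y :- w) :+ w :* (x :- z)) refl

    *-cauchy : ∀ f g → IsCauchy f → IsCauchy g → IsCauchy (λ n → f n ℚ.* g n)
    *-cauchy f g cf cg ε ε>0 =
      let (A , A>0 , N₁ , a)  = eventually-bounded f cf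
          (B , B>0 , N₂ , b)  = eventually-bounded g cg
          (δ₁ , δ₁>0 , Bδ₁≡)  = divide B>0 (½>0 ε>0)
          (δ₂ , δ₂>0 , Aδ₂≡)  = divide A>0 (½>0 ε>0)
          (N₃ , p)            = cf δ₁ δ₁>0
          (N₄ , q)            = cg δ₂ δ₂>0
      in (N₁ ℕ.⊔ N₂) ℕ.⊔ (N₃ ℕ.⊔ N₄) , λ m n m≥ n≥ →
        let m₁₂ = ℕₚ.m⊔n≤o⇒m≤o (N₁ ℕ.⊔ N₂) (N₃ ℕ.⊔ N₄) m≥
            m₃₄ = ℕₚ.m⊔n≤o⇒n≤o (N₁ ℕ.⊔ N₂) (N₃ ℕ.⊔ N₄) m≥
            n₁₂ = ℕₚ.m⊔n≤o⇒m≤o (N₁ ℕ.⊔ N₂) (N₃ ℕ.⊔ N₄) n≥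
            n₃₄ = ℕₚ.m⊔n≤o⇒n≤o (N₁ ℕ.⊔ N₂) (N₃ ℕ.⊔ N₄) n≥
        in combine (f m) (g m) (f n) (g n)
             (∣ab∣<Bδ {f m} A>0 (a m (ℕₚ.m⊔n≤o⇒m≤o N₁ N₂ m₁₂))
               (q m n (ℕₚ.m⊔n≤o⇒n≤o N₃ N₄ m₃₄) (ℕₚ.m⊔n≤o⇒n≤o N₃ N₄ n₃₄)))
             (∣ab∣<Bδ {g n} B>0 (b n (ℕₚ.m⊔n≤o⇒n≤o N₁ N₂ n₁₂))
               (p m n (ℕₚ.m⊔n≤o⇒m≤o N₃ N₄ m₃₄) (ℕₚ.m⊔n≤o⇒m≤o N₃ N₄ n₃₄)))
             (trans (cong₂ ℚ._+_ Aδ₂≡ Bδ₁≡) (½+½ ε))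
      where
      open ≤-Reasoning
      combine : ∀ x y z w {s t} → ∣ x ℚ.* (y ℚ.- w) ∣ ℚ.< s → ∣ w ℚ.* (x ℚ.- z) ∣ ℚ.< t →
        s ℚ.+ t ≡ ε → ∣ x ℚ.* y ℚ.- z ℚ.* w ∣ ℚ.< ε
      combine x y z w {s} {t} h₁ h₂ s+t≡ε = begin-strict
        ∣ x ℚ.* y ℚ.- z ℚ.* w ∣
          ≡⟨ cong ∣_∣ (product-difference x y z w) ⟩
        ∣ x ℚ.* (y ℚ.- w) ℚ.+ w ℚ.* (x ℚ.- z) ∣
          ≤⟨ ℚₚ.∣p+q∣≤∣p∣+∣q∣ (x ℚ.* (y ℚ.- w)) (w ℚ.* (x ℚ.- z)) ⟩
        ∣ x ℚ.* (y ℚ.- w) ∣ ℚ.+ ∣ w ℚ.* (x ℚ.- z) ∣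
          <⟨ ℚₚ.+-mono-< h₁ h₂ ⟩
        s ℚ.+ t
          ≡⟨ s+t≡ε ⟩
        ε ∎

open ArithmeticLemmas

infixl 6 _+_ _-_
infixl 7 _*_
infix  8 -_
infixr 8 _^_

fromℚ : ℚ → ℝ
fromℚ q = mkℝ (λ _ → q) (const-cauchy q)

0ℝ 1ℝ : ℝ
0ℝ = fromℚ 0ℚ
1ℝ = fromℚ 1ℚ

_+_ : ℝ → ℝ → ℝ
x + y = mkℝ (λ n → seq x n ℚ.+ seq y n) (+-cauchy (seq x) (seq y) (cauchy x) (cauchy y))

-_ : ℝ → ℝ
- x = mkℝ (λ n → ℚ.- seq x n) (neg-cauchy (seq x) (cauchy x))

_-_ : ℝ → ℝ → ℝ
x - y = x + (- y)

_*_ : ℝ → ℝ → ℝ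
x * y = mkℝ (λ n → seq x n ℚ.* seq y n) (*-cauchy (seq x) (seq y) (cauchy x) (cauchy y))

_^_ : ℝ → ℕ → ℝ
x ^ zero  = 1ℝ
x ^ suc k = x * x ^ k

sumℝ : List ℝ → ℝ
sumℝ = foldr _+_ 0ℝ

------------------------------------------------------------------------
-- Reciprocals of reals whose approximations are all at least 1.

module InverseSign where
  ≥1⇒pos : ∀ {q} → 1ℚ ℚ.≤ q → Positive q
  ≥1⇒pos 1≤q = positive (ℚₚ.<-≤-trans (ℚₚ.positive⁻¹ 1ℚ) 1≤q)

open InverseSign

inv : ∀ q → 1ℚ ℚ.≤ q → ℚ
inv q 1≤q = (ℚ.1/ q) {{ℚₚ.pos⇒nonZero q {{≥1⇒pos 1≤q}}}}

module InverseLemmas where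
  abstract
    inv-inverseʳ : ∀ q (h : 1ℚ ℚ.≤ q) → q ℚ.* inv q h ≡ 1ℚ
    inv-inverseʳ q h = ℚₚ.*-inverseʳ q {{ℚₚ.pos⇒nonZero q {{≥1⇒pos h}}}}

    inv-pos : ∀ q (h : 1ℚ ℚ.≤ q) → Positive (inv q h)
    inv-pos q h = ℚₚ.1/pos⇒pos q {{≥1⇒pos h}}

    inv≤1 : ∀ q (h : 1ℚ ℚ.≤ q) → inv q h ℚ.≤ 1ℚ
    inv≤1 q h = begin
      inv q h           ≡⟨ sym (ℚₚ.*-identityˡ (inv q h)) ⟩
      1ℚ ℚ.* inv q h    ≤⟨ ℚₚ.*-monoʳ-≤-nonNeg (inv q h) {{ℚₚ.pos⇒nonNeg (inv q h) {{inv-pos q h}}}} h ⟩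
      q ℚ.* inv q h     ≡⟨ inv-inverseʳ q h ⟩
      1ℚ ∎
      where open ≤-Reasoning

    ∣inv∣≤1 : ∀ q (h : 1ℚ ℚ.≤ q) → ∣ inv q h ∣ ℚ.≤ 1ℚ
    ∣inv∣≤1 q h = subst (ℚ._≤ 1ℚ)
      (sym (ℚₚ.0≤p⇒∣p∣≡p (ℚₚ.<⇒≤ (ℚₚ.positive⁻¹ (inv q h) {{inv-pos q h}}))))
      (inv≤1 q h)

    inv-contract : ∀ p q (hp : 1ℚ ℚ.≤ p) (hq : 1ℚ ℚ.≤ q) →
      ∣ inv p hp ℚ.- inv q hq ∣ ℚ.≤ ∣ p ℚ.- q ∣
    inv-contract p q hp hq = begin
      ∣ a ℚ.- b ∣
        ≡⟨ cong₂ (λ u v → ∣ u ℚ.- v ∣) (sym (ℚₚ.*-identityʳ a)) (sym (ℚₚ.*-identityʳ b)) ⟩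
      ∣ a ℚ.* 1ℚ ℚ.- b ℚ.* 1ℚ ∣
        ≡⟨ cong₂ (λ u v → ∣ a ℚ.* u ℚ.- b ℚ.* v ∣) (sym (inv-inverseʳ q hq)) (sym (inv-inverseʳ p hp)) ⟩
      ∣ a ℚ.* (q ℚ.* b) ℚ.- b ℚ.* (p ℚ.* a) ∣
        ≡⟨ cong ∣_∣ (solve 4 (λ a b p q → a :* (q :* b) :- b :* (p :* a) := a :* (b :* (q :- p))) refl a b p q) ⟩
      ∣ a ℚ.* (b ℚ.* (q ℚ.- p)) ∣ ≤⟨ shrink a _ (∣inv∣≤1 p hp) ⟩
      ∣ b ℚ.* (q ℚ.- p) ∣         ≤⟨ shrink b _ (∣inv∣≤1 q hq) ⟩
      ∣ q ℚ.- p ∣                 ≡⟨ ∣∣-sym q p ⟩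
      ∣ p ℚ.- q ∣ ∎
      where
      open ≤-Reasoning
      a b : ℚ
      a = inv p hp
      b = inv q hq
      shrink : ∀ u v → ∣ u ∣ ℚ.≤ 1ℚ → ∣ u ℚ.* v ∣ ℚ.≤ ∣ v ∣
      shrink u v h = begin
        ∣ u ℚ.* v ∣      ≡⟨ ℚₚ.∣p*q∣≡∣p∣*∣q∣ u v ⟩
        ∣ u ∣ ℚ.* ∣ v ∣  ≤⟨ ℚₚ.*-monoʳ-≤-nonNeg ∣ v ∣ {{ℚₚ.∣-∣-nonNeg v}} h ⟩
        1ℚ ℚ.* ∣ v ∣     ≡⟨ ℚₚ.*-identityˡ ∣ v ∣ ⟩
        ∣ v ∣ ∎

open InverseLemmas

abstract
  recip-cauchy : ∀ x (h : ∀ n → 1ℚ ℚ.≤ seq x n) → IsCauchy (λ n → inv (seq x n) (h n))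
  recip-cauchy x h ε ε>0 =
    let (N , p) = cauchy x ε ε>0 in
    N , λ m n m≥ n≥ →
      ℚₚ.≤-<-trans (inv-contract (seq x m) (seq x n) (h m) (h n)) (p m n m≥ n≥)

recip : (x : ℝ) → (∀ n → 1ℚ ℚ.≤ seq x n) → ℝ
recip x h = mkℝ (λ n → inv (seq x n) (h n)) (recip-cauchy x h)

*-recip : ∀ x h → x * recip x h ≈ 1ℝ
*-recip x h = mk≈ λ ε ε>0 → 0 , λ n _ → subst (λ q → ∣ q ℚ.- 1ℚ ∣ ℚ.< ε)
  (sym (inv-inverseʳ (seq x n) (h n))) ε>0

------------------------------------------------------------------------
-- e = Σ 1/k!

1/_! : ℕ → ℚ
1/ k ! = (+ 1 ℚ./ k !) {{k ℕₚ.!≢0}}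

expSum : ℕ → ℚ
expSum zero    = 1/ 0 !
expSum (suc n) = expSum n ℚ.+ 1/ suc n !

module ExpSumLemmas where
  abstract
    unit-* : ∀ a b .{{_ : ℕ.NonZero a}} .{{_ : ℕ.NonZero b}} .{{_ : ℕ.NonZero (a ℕ.* b)}} →
      + 1 ℚ./ (a ℕ.* b) ≡ (+ 1 ℚ./ a) ℚ.* (+ 1 ℚ./ b)
    unit-* (suc a) (suc b) = ℚₚ.toℚᵘ-injective (begin-equality
      toℚᵘ (+ 1 ℚ./ (suc a ℕ.* suc b))
        ≃⟨ ℚₚ.toℚᵘ-fromℚᵘ (ℚᵘ.mkℚᵘ (+ 1) (b ℕ.+ a ℕ.* suc b)) ⟩
      ℚᵘ.mkℚᵘ (+ 1) a ℚᵘ.* ℚᵘ.mkℚᵘ (+ 1) b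
        ≃⟨ ℚᵘₚ.*-cong (ℚᵘₚ.≃-sym (ℚₚ.toℚᵘ-fromℚᵘ (ℚᵘ.mkℚᵘ (+ 1) a))) (ℚᵘₚ.≃-sym (ℚₚ.toℚᵘ-fromℚᵘ (ℚᵘ.mkℚᵘ (+ 1) b))) ⟩
      toℚᵘ (+ 1 ℚ./ suc a) ℚᵘ.* toℚᵘ (+ 1 ℚ./ suc b)
        ≃⟨ ℚᵘₚ.≃-sym (ℚₚ.toℚᵘ-homo-* (+ 1 ℚ./ suc a) (+ 1 ℚ./ suc b)) ⟩
      toℚᵘ ((+ 1 ℚ./ suc a) ℚ.* (+ 1 ℚ./ suc b)) ∎)
      where open ℚᵘₚ.≤-Reasoning

    unit-antitone : ∀ {a b} → a ℕ.≤ b → + 1 ℚ./ suc b ℚ.≤ + 1 ℚ./ suc a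
    unit-antitone {a} {b} a≤b = ℚₚ.toℚᵘ-cancel-≤ (begin
      toℚᵘ (+ 1 ℚ./ suc b)   ≃⟨ ℚₚ.toℚᵘ-fromℚᵘ (ℚᵘ.mkℚᵘ (+ 1) b) ⟩
      ℚᵘ.mkℚᵘ (+ 1) b
        ≤⟨ ℚᵘ.*≤* (ℤ.+≤+ (ℕₚ.+-monoˡ-≤ 0 (ℕ.s≤s a≤b))) ⟩
      ℚᵘ.mkℚᵘ (+ 1) a        ≃⟨ ℚᵘₚ.≃-sym (ℚₚ.toℚᵘ-fromℚᵘ (ℚᵘ.mkℚᵘ (+ 1) a)) ⟩
      toℚᵘ (+ 1 ℚ./ suc a) ∎)
      where open ℚᵘₚ.≤-Reasoning

    archimedean : ∀ ε → 0ℚ ℚ.< ε → ∃ λ N → + 1 ℚ./ suc N ℚ.< ε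
    archimedean (mkℚ (+ 0) d c) (*<* (ℤ.+<+ ()))
    archimedean ε@(mkℚ +[1+ p ] d c) _ = suc d , ℚₚ.toℚᵘ-cancel-< (begin-strict
      toℚᵘ (+ 1 ℚ./ suc (suc d)) ≃⟨ ℚₚ.toℚᵘ-fromℚᵘ (ℚᵘ.mkℚᵘ (+ 1) (suc d)) ⟩
      ℚᵘ.mkℚᵘ (+ 1) (suc d)
        <⟨ ℚᵘ.*<* (ℤ.+<+ (ℕₚ.<-≤-trans
             (subst (ℕ._< suc (suc d)) (sym (ℕₚ.+-identityʳ (suc d))) (ℕₚ.n<1+n (suc d)))
             (ℕₚ.m≤m+n (suc (suc d)) (p ℕ.* suc (suc d))))) ⟩
      toℚᵘ ε ∎)
      where open ℚᵘₚ.≤-Reasoning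

    unit-pos : ∀ a .{{_ : ℕ.NonZero a}} → Positive (+ 1 ℚ./ a)
    unit-pos (suc a) = ℚₚ.normalize-pos 1 (suc a)

    fact-pos : ∀ k → Positive (1/ k !)
    fact-pos k = unit-pos (k !) {{k ℕₚ.!≢0}}

    fact-nonNeg : ∀ k → NonNegative (1/ k !)
    fact-nonNeg k = ℚₚ.pos⇒nonNeg (1/ k !) {{fact-pos k}}

    fact-step : ∀ k → 1/ suc k ! ≡ (+ 1 ℚ./ suc k) ℚ.* 1/ k !
    fact-step k = unit-* (suc k) (k !) {{_}} {{k ℕₚ.!≢0}} {{suc k ℕₚ.!≢0}}

    fact-shrink : ∀ {j} k → j ℕ.≤ k → 1/ suc k ! ℚ.≤ (+ 1 ℚ./ suc j) ℚ.* 1/ k !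
    fact-shrink {j} k j≤k = subst (ℚ._≤ (+ 1 ℚ./ suc j) ℚ.* 1/ k !) (sym (fact-step k))
      (ℚₚ.*-monoʳ-≤-nonNeg (1/ k !) {{fact-nonNeg k}} (unit-antitone j≤k))

    fact≤1 : ∀ k → 1/ k ! ℚ.≤ 1ℚ
    fact≤1 zero    = ℚₚ.≤-refl
    fact≤1 (suc k) = ℚₚ.≤-trans (fact-shrink k ℕ.z≤n)
      (subst (ℚ._≤ 1ℚ) (sym (ℚₚ.*-identityˡ (1/ k !))) (fact≤1 k))

    fact≤unit : ∀ k → 1/ suc k ! ℚ.≤ + 1 ℚ./ suc k
    fact≤unit k = begin
      1/ suc k !                    ≡⟨ fact-step k ⟩
      (+ 1 ℚ./ suc k) ℚ.* 1/ k !
        ≤⟨ ℚₚ.*-monoˡ-≤-nonNeg (+ 1 ℚ./ suc k) {{ℚₚ.pos⇒nonNeg (+ 1 ℚ./ suc k) {{unit-pos (suc k)}}}} (fact≤1 k) ⟩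
      (+ 1 ℚ./ suc k) ℚ.* 1ℚ        ≡⟨ ℚₚ.*-identityʳ (+ 1 ℚ./ suc k) ⟩
      + 1 ℚ./ suc k ∎
      where open ≤-Reasoning

    expSum-step : ∀ n → expSum n ℚ.≤ expSum (suc n)
    expSum-step n = subst (ℚ._≤ expSum (suc n)) (ℚₚ.+-identityʳ (expSum n))
      (ℚₚ.+-monoʳ-≤ (expSum n) (ℚₚ.nonNegative⁻¹ (1/ suc n !) {{fact-nonNeg (suc n)}}))

    expSum-mono : ∀ {m n} → m ℕ.≤′ n → expSum m ℚ.≤ expSum n
    expSum-mono ℕ.≤′-refl         = ℚₚ.≤-refl
    expSum-mono (ℕ.≤′-step {n} h) = ℚₚ.≤-trans (expSum-mono h) (expSum-step n)

    upper : ℕ → ℚ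
    upper n = expSum n ℚ.+ 1/ n !

    upper-step : ∀ n → upper (suc (suc n)) ℚ.≤ upper (suc n)
    upper-step n = begin
      (expSum (suc n) ℚ.+ f) ℚ.+ f  ≡⟨ ℚₚ.+-assoc (expSum (suc n)) f f ⟩
      expSum (suc n) ℚ.+ (f ℚ.+ f)
        ≤⟨ ℚₚ.+-monoʳ-≤ (expSum (suc n)) (ℚₚ.+-mono-≤ f≤ f≤) ⟩
      expSum (suc n) ℚ.+ (½ ℚ.* 1/ suc n ! ℚ.+ ½ ℚ.* 1/ suc n !)
        ≡⟨ cong (expSum (suc n) ℚ.+_) (½+½ (1/ suc n !)) ⟩
      expSum (suc n) ℚ.+ 1/ suc n ! ∎
      where
      open ≤-Reasoning
      f : ℚ
      f = 1/ suc (suc n) !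
      f≤ : f ℚ.≤ ½ ℚ.* 1/ suc n !
      f≤ = fact-shrink (suc n) (ℕ.s≤s ℕ.z≤n)

    upper-anti : ∀ {m n} → suc m ℕ.≤′ n → upper n ℚ.≤ upper (suc m)
    upper-anti ℕ.≤′-refl               = ℚₚ.≤-refl
    upper-anti (ℕ.≤′-step {suc n} h)   = ℚₚ.≤-trans (upper-step n) (upper-anti h)
    upper-anti {m} (ℕ.≤′-step {zero} h) with ℕₚ.≤′⇒≤ h
    ... | ()

    expSum≤upper : ∀ n → expSum n ℚ.≤ upper n
    expSum≤upper n = subst (ℚ._≤ upper n) (ℚₚ.+-identityʳ (expSum n))
      (ℚₚ.+-monoʳ-≤ (expSum n) (ℚₚ.nonNegative⁻¹ (1/ n !) {{fact-nonNeg n}}))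

    expSum-cauchy : IsCauchy expSum
    expSum-cauchy ε ε>0 with archimedean ε ε>0
    ... | N , 1/N<ε = suc N , λ m n m≥ n≥ → begin-strict
      ∣ expSum m ℚ.- expSum n ∣
        ≤⟨ interval (lo m≥) (hi m≥) (lo n≥) (hi n≥) ⟩
      upper (suc N) ℚ.- expSum (suc N)
        ≡⟨ solve 2 (λ a b → (a :+ b) :- a := b) refl (expSum (suc N)) (1/ suc N !) ⟩
      1/ suc N !      ≤⟨ fact≤unit N ⟩
      + 1 ℚ./ suc N   <⟨ 1/N<ε ⟩
      ε ∎
      where
      open ≤-Reasoning
      lo : ∀ {k} → suc N ℕ.≤ k → expSum (suc N) ℚ.≤ expSum k
      lo h = expSum-mono (ℕₚ.≤⇒≤′ h)
      hi : ∀ {k} → suc N ℕ.≤ k → expSum k ℚ.≤ upper (suc N)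
      hi {k} h = ℚₚ.≤-trans (expSum≤upper k) (upper-anti (ℕₚ.≤⇒≤′ h))

open ExpSumLemmas

e : ℝ
e = mkℝ expSum expSum-cauchy

1/e : ℝ
1/e = recip e (λ n → expSum-mono {0} {n} (ℕₚ.≤⇒≤′ ℕ.z≤n))

------------------------------------------------------------------------
-- Instances.  For ρ > 1 the map k ↦ ρ ^ k is strictly increasing
-- (^-strictMono), so a finite set W ⊂ {1, ρ, ρ², …} is given by a
-- duplicate-free list of exponents, its subsets by sublists of that list,
-- and the maximum of an instance is the value with the largest exponent.

module PowerLemmas where
  rational-^ : ℚ → ℕ → ℚ
  rational-^ q zero    = 1ℚ
  rational-^ q (suc k) = q ℚ.* rational-^ q k

  seq-^ : ∀ x k n → seq (x ^ k) n ≡ rational-^ (seq x n) k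
  seq-^ x zero    n = refl
  seq-^ x (suc k) n = cong (seq x n ℚ.*_) (seq-^ x k n)

  module _ {q ε : ℚ} (ε>0 : 0ℚ ℚ.< ε) (h : 1ℚ ℚ.+ ε ℚ.≤ q) where
    open ≤-Reasoning

    pow≥1 : ∀ k → 1ℚ ℚ.≤ rational-^ q k
    pow-step : ∀ k → rational-^ q k ℚ.+ ε ℚ.≤ rational-^ q (suc k)

    pow≥1 zero    = ℚₚ.≤-refl
    pow≥1 (suc k) = begin
      1ℚ                     ≤⟨ pow≥1 k ⟩
      rational-^ q k         ≡⟨ sym (ℚₚ.+-identityʳ _) ⟩
      rational-^ q k ℚ.+ 0ℚ  ≤⟨ ℚₚ.+-monoʳ-≤ (rational-^ q k) (ℚₚ.<⇒≤ ε>0) ⟩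
      rational-^ q k ℚ.+ ε   ≤⟨ pow-step k ⟩
      rational-^ q (suc k) ∎

    pow-step k = begin
      p ℚ.+ ε               ≡⟨ cong (p ℚ.+_) (sym (ℚₚ.*-identityʳ ε)) ⟩
      p ℚ.+ ε ℚ.* 1ℚ        ≤⟨ ℚₚ.+-monoʳ-≤ p (ℚₚ.*-monoˡ-≤-nonNeg ε {{nonNegative (ℚₚ.<⇒≤ ε>0)}} (pow≥1 k)) ⟩
      p ℚ.+ ε ℚ.* p         ≡⟨ cong (ℚ._+ ε ℚ.* p) (sym (ℚₚ.*-identityˡ p)) ⟩
      1ℚ ℚ.* p ℚ.+ ε ℚ.* p  ≡⟨ sym (ℚₚ.*-distribʳ-+ p 1ℚ ε) ⟩
      (1ℚ ℚ.+ ε) ℚ.* p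
        ≤⟨ ℚₚ.*-monoʳ-≤-nonNeg p {{ℚₚ.pos⇒nonNeg p {{≥1⇒pos (pow≥1 k)}}}} h ⟩
      q ℚ.* p ∎
      where
      p : ℚ
      p = rational-^ q k

    pow-mono : ∀ {k l} → suc k ℕ.≤′ l → rational-^ q k ℚ.+ ε ℚ.≤ rational-^ q l
    pow-mono {k} ℕ.≤′-refl          = pow-step k
    pow-mono {k} (ℕ.≤′-step {l} k<l) = begin
      rational-^ q k ℚ.+ ε   ≤⟨ pow-mono k<l ⟩
      rational-^ q l         ≡⟨ sym (ℚₚ.+-identityʳ _) ⟩
      rational-^ q l ℚ.+ 0ℚ  ≤⟨ ℚₚ.+-monoʳ-≤ (rational-^ q l) (ℚₚ.<⇒≤ ε>0) ⟩
      rational-^ q l ℚ.+ ε   ≤⟨ pow-step l ⟩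
      rational-^ q (suc l) ∎

open PowerLemmas

^-strictMono : ∀ {ρ} → 1ℝ < ρ → ∀ {k l} → k ℕ.< l → ρ ^ k < ρ ^ l
^-strictMono {ρ} (mk< ε ε>0 (N , h)) {k} {l} k<l = mk< ε ε>0 (N , λ n n≥ →
  subst (λ u → u ℚ.+ ε ℚ.≤ seq (ρ ^ l) n) (sym (seq-^ ρ k n))
    (subst (rational-^ (seq ρ n) k ℚ.+ ε ℚ.≤_) (sym (seq-^ ρ l n))
      (pow-mono {seq ρ n} {ε} ε>0 (h n n≥) {k} {l} (ℕₚ.≤⇒≤′ k<l))))

choose : {A : Set} → ℕ → List A → List (List A)
choose zero    xs       = [ [] ]
choose (suc n) []       = []
choose (suc n) (x ∷ xs) = map (x ∷_) (choose n xs) ++ choose (suc n) xs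

insertions : {A : Set} → A → List A → List (List A)
insertions x []       = [ [ x ] ]
insertions x (y ∷ ys) = (x ∷ y ∷ ys) ∷ map (y ∷_) (insertions x ys)

permutations : {A : Set} → List A → List (List A)
permutations []       = [ [] ]
permutations (x ∷ xs) = concatMap (insertions x) (permutations xs)

record FiniteExponentSet : Set where
  field
    elements : List ℕ
    unique   : Unique elements

open FiniteExponentSet public

-- Only the values of weight on  choose n (elements W)  matter.
record Distribution (n : ℕ) (W : FiniteExponentSet) : Set where
  field
    weight   : List ℕ → ℝ
    weight≥0 : ∀ {S} → S ∈ choose n (elements W) → 0ℝ ≤ weight S
    total    : sumℝ (map weight (choose n (elements W))) ≈ 1ℝ

open Distribution public

------------------------------------------------------------------------
-- Algorithms.  accept (v₁ ∷ … ∷ vᵢ ∷ []) is the probability of stopping at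
-- time i and taking vᵢ, given that v₁, …, vᵢ were seen and v₁, …, vᵢ₋₁ rejected.

record Algorithm : Set where
  field
    accept      : List ℝ → ℝ
    accept-cong : ∀ {vs ws} → Pointwise _≈_ vs ws → accept vs ≈ accept ws
    accept≥0    : ∀ vs → 0ℝ ≤ accept vs
    accept≤1    : ∀ vs → accept vs ≤ 1ℝ

open Algorithm public

maxIndicator : List ℕ → ℕ → ℝ
maxIndicator S k = if ⌊ all? (ℕₚ._≤? k) S ⌋ then 1ℝ else 0ℝ

-- The conditional probability of eventually accepting the maximum of S when
-- the values with exponents  seen  have been rejected and  rest  is to come.
winFrom : ℝ → Algorithm → (S seen rest : List ℕ) → ℝ
winFrom ρ A S seen []         = 0ℝ
winFrom ρ A S seen (k ∷ rest) =
  a * maxIndicator S k + (1ℝ - a) * winFrom ρ A S (seen ∷ʳ k) rest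
  where
  a : ℝ
  a = accept A (map (ρ ^_) (seen ∷ʳ k))

successOn : (n : ℕ) → ℝ → Algorithm → List ℕ → ℝ
successOn n ρ A S =
  fromℚ (1/ n !) * sumℝ (map (winFrom ρ A S []) (permutations S))

successProbability : (ρ : ℝ) (n : ℕ) (W : FiniteExponentSet) → Distribution n W → Algorithm → ℝ
successProbability ρ n W D A =
  sumℝ (map (λ S → weight D S * successOn n ρ A S) (choose n (elements W)))

{-# OPTIONS --safe #-}
module Submission where

-- An instance S ⊂ {0, …, H − 1} of n exponents gets weight proportional to
-- 1 / ((m + 1) m ⋯ (m − n + 2)) with m = max S.  Under this prior the values seen
-- tell essentially nothing beyond their relative ranks: after rejecting i values with maximum
-- m, the optimal success weight still to come is at most
-- (optimum i r) / ((m + 1) m ⋯ (m − i + 2)), r = n − i, where  optimum  obeys the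
-- recursion of the rank-based secretary problem.  The step of the induction is a
-- telescoping sum over the possible next records, and the finite range only helps
-- it.  The one loss is in the normalisation: the bound carries harmonic H where the
-- total weight has harmonic H − harmonic (n − 1), and the quotient tends to 1.  The
-- recursion itself is solved by harmonic sums, compared with e via
-- exp (1/k) ≤ k / (k − 1).

import Data.Integer.Base as ℤ
import Data.Integer.Properties as ℤₚ
import Data.List.Relation.Binary.Permutation.Setoid.Properties as ↭ₛ
import Data.List.Relation.Unary.All.Properties as Allₚ
import Data.Nat.Properties as ℕₚ
import Data.Rational.Unnormalised.Base as ℚᵘ
import Data.Rational.Unnormalised.Properties as ℚᵘₚ
open import Data.Bool.Base using (if_then_else_)
open import Data.List.Base using (List; []; _∷_; _++_; [_]; map; concatMap; foldr; length; downFrom; _∷ʳ_)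
open import Data.List.Membership.Propositional.Properties using (∈-downFrom⁻)
open import Data.List.Properties using (length-++; ∷ʳ-++; length-downFrom)
open import Data.List.Relation.Binary.Permutation.Propositional as ↭ using (_↭_; ↭-sym; ↭⇒↭ₛ)
open import Data.List.Relation.Binary.Permutation.Propositional.Properties using (All-resp-↭; ++⁺ˡ; ↭-length)
open import Data.List.Relation.Unary.All as All using (All; []; _∷_; all?)
open import Data.List.Relation.Unary.AllPairs using (_∷_)
open import Data.List.Relation.Unary.Unique.Propositional using (Unique)
open import Data.List.Relation.Unary.Unique.Propositional.Properties using (downFrom⁺)
open import Data.Nat.Base as ℕ using (ℕ; zero; suc; _∸_)
open import Data.Product.Base using (∃; Σ-syntax; _×_; _,_; proj₁; proj₂)
open import Data.Rational.Base as ℚ using (ℚ; 0ℚ; 1ℚ; ½; toℚᵘ; nonNegative)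
open import Data.Rational.Properties as ℚₚ using (module ≤-Reasoning)
open import Data.Rational.Solver using (module +-*-Solver)
open import Data.Sum.Base using (_⊎_; inj₁; inj₂)
open import Relation.Binary.PropositionalEquality using (_≡_; _≢_; refl; sym; trans; cong; cong₂; subst)
open import Relation.Binary.PropositionalEquality.Properties using (setoid)
open import Relation.Nullary using (yes; no; contradiction)
open import Relation.Nullary.Decidable using (⌊_⌋)
open import Defs using (1/_!; expSum; inv; choose; insertions; permutations; module ArithmeticLemmas; module ExpSumLemmas; module InverseLemmas; module PowerLemmas)

-- The weight comes from drawing the maximum m with probability proportional to 1 / (m + 1) and then
-- a uniform (n - 1)-subset of the numbers below m: there are C(m, n - 1) such subsets, and (n - 1)!
-- C(m, n - 1) times the weight is 1 / (m + 1). The maximum is thus spread almost evenly on a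
-- logarithmic scale, so its size says almost nothing about whether a larger value is still to come.
-- As the harmonic series diverges, this prior has no version on all of ℕ, which is why a cut-off H
-- is needed. The algorithm does not see S, so backward induction has to run over prefixes and not
-- over a fixed instance. Drawing S and permuting it is therefore rewritten as drawing n elements
-- one after the other. The weights are rational; only the acceptance probabilities are real. The
-- better of accepting and rejecting is hence formed on rational bounds, and since the operations on
-- reals act termwise, identities between success probabilities become equalities of rationals at
-- every index.

-- Reciprocal falling factorials over ℚ

module RationalArithmetic where
  open import Data.Rational.Base using (_+_; _*_; _-_; _≤_; _<_)
  open +-*-Solver

  *-monoˡ-≤ : ∀ {r p q} → 0ℚ ≤ r → p ≤ q → r * p ≤ r * q
  *-monoˡ-≤ {r} 0≤r = ℚₚ.*-monoˡ-≤-nonNeg r {{nonNegative 0≤r}}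

  *-monoʳ-≤ : ∀ {r p q} → 0ℚ ≤ r → p ≤ q → p * r ≤ q * r
  *-monoʳ-≤ {r} 0≤r = ℚₚ.*-monoʳ-≤-nonNeg r {{nonNegative 0≤r}}

  0≤* : ∀ {p q} → 0ℚ ≤ p → 0ℚ ≤ q → 0ℚ ≤ p * q
  0≤* {p} {q} 0≤p 0≤q = ℚₚ.nonNegative⁻¹ (p * q)
    {{ℚₚ.nonNeg*nonNeg⇒nonNeg p {{nonNegative 0≤p}} q {{nonNegative 0≤q}}}}

  0≤+ : ∀ {p q} → 0ℚ ≤ p → 0ℚ ≤ q → 0ℚ ≤ p + q
  0≤+ = ℚₚ.+-mono-≤

  0≤1 : 0ℚ ≤ 1ℚ
  0≤1 = ℚₚ.nonNegative⁻¹ 1ℚ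

  ≤-slack : ∀ {p q} d → 0ℚ ≤ d → p + d ≡ q → p ≤ q
  ≤-slack {p} d 0≤d refl = ℚₚ.≤-trans (ℚₚ.≤-reflexive (sym (ℚₚ.+-identityʳ p))) (ℚₚ.+-monoʳ-≤ p 0≤d)

  0≤q-p : ∀ {p q} → p ≤ q → 0ℚ ≤ q - p
  0≤q-p {p} {q} p≤q = subst (_≤ q - p) (ℚₚ.+-inverseʳ p) (ℚₚ.+-monoˡ-≤ (ℚ.- p) p≤q)

  ι : ℕ → ℚ
  ι zero    = 0ℚ
  ι (suc n) = 1ℚ + ι n

  -- The junk value ⅟ 0 = 0 makes R-last hold for all arguments.
  ⅟ : ℕ → ℚ
  ⅟ zero    = 0ℚ
  ⅟ (suc n) = ℤ.+ 1 ℚ./ suc n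

  ι≥0 : ∀ n → 0ℚ ≤ ι n
  ι≥0 zero    = ℚₚ.≤-refl
  ι≥0 (suc n) = 0≤+ 0≤1 (ι≥0 n)

  ⅟≥0 : ∀ n → 0ℚ ≤ ⅟ n
  ⅟≥0 zero    = ℚₚ.≤-refl
  ⅟≥0 (suc n) = ℚₚ.<⇒≤ (ℚₚ.positive⁻¹ _ {{ExpSumLemmas.unit-pos (suc n)}})

  ι-+ : ∀ m n → ι (m ℕ.+ n) ≡ ι m + ι n
  ι-+ zero    n = sym (ℚₚ.+-identityˡ (ι n))
  ι-+ (suc m) n = trans (cong (1ℚ +_) (ι-+ m n)) (sym (ℚₚ.+-assoc 1ℚ (ι m) (ι n)))

  ι-mono : ∀ {m n} → m ℕ.≤ n → ι m ≤ ι n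
  ι-mono {n = n} ℕ.z≤n = ι≥0 n
  ι-mono (ℕ.s≤s m≤n) = ℚₚ.+-monoʳ-≤ 1ℚ (ι-mono m≤n)

  ι-cancel-≤ : ∀ {m n} → ι m ≤ ι n → m ℕ.≤ n
  ι-cancel-≤ {m} {n} ιm≤ιn with m ℕₚ.≤? n
  ... | yes m≤n = m≤n
  ... | no  m≰n with ℚₚ.<-irrefl refl (ℚₚ.<-≤-trans ιn<ιm ιm≤ιn)
    where
    ιn<ιm : ι n < ι m
    ιn<ιm = ℚₚ.<-≤-trans
      (subst (_< 1ℚ + ι n) (ℚₚ.+-identityˡ (ι n)) (ℚₚ.+-monoˡ-< (ι n) (ℚₚ.positive⁻¹ 1ℚ)))
      (ι-mono (ℕₚ.≰⇒> m≰n))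
  ... | ()

  toℚᵘ-ι : ∀ n → toℚᵘ (ι n) ℚᵘ.≃ ℚᵘ.mkℚᵘ (ℤ.+ n) 0
  toℚᵘ-ι zero    = ℚᵘₚ.≃-refl
  toℚᵘ-ι (suc n) = begin-equality
    toℚᵘ (1ℚ + ι n)                      ≃⟨ ℚₚ.toℚᵘ-homo-+ 1ℚ (ι n) ⟩
    toℚᵘ 1ℚ ℚᵘ.+ toℚᵘ (ι n)              ≃⟨ ℚᵘₚ.+-congʳ (toℚᵘ 1ℚ) (toℚᵘ-ι n) ⟩
    toℚᵘ 1ℚ ℚᵘ.+ ℚᵘ.mkℚᵘ (ℤ.+ n) 0         ≃⟨ ℚᵘ.*≡* (cong (ℤ._* ℤ.+ 1) (cong (ℤ._+_ (ℤ.+ 1)) (ℤₚ.*-identityʳ (ℤ.+ n)))) ⟩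
    ℚᵘ.mkℚᵘ (ℤ.+ suc n) 0 ∎
    where open ℚᵘₚ.≤-Reasoning

  ι*⅟ : ∀ n → ι (suc n) * ⅟ (suc n) ≡ 1ℚ
  ι*⅟ n = ℚₚ.toℚᵘ-injective (begin-equality
    toℚᵘ (ι (suc n) * ⅟ (suc n))              ≃⟨ ℚₚ.toℚᵘ-homo-* (ι (suc n)) (⅟ (suc n)) ⟩
    toℚᵘ (ι (suc n)) ℚᵘ.* toℚᵘ (⅟ (suc n))
      ≃⟨ ℚᵘₚ.*-cong (toℚᵘ-ι (suc n)) (ℚₚ.toℚᵘ-fromℚᵘ (ℚᵘ.mkℚᵘ (ℤ.+ 1) n)) ⟩
    ℚᵘ.mkℚᵘ (ℤ.+ suc n) 0 ℚᵘ.* ℚᵘ.mkℚᵘ (ℤ.+ 1) n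
      ≃⟨ ℚᵘ.*≡* (trans (ℤₚ.*-identityʳ _) (trans (ℤₚ.*-identityʳ (ℤ.+ suc n))
           (sym (trans (ℤₚ.*-identityˡ _) (cong (λ k → ℤ.+ suc k) (ℕₚ.+-identityʳ n)))))) ⟩
    toℚᵘ 1ℚ ∎)
    where open ℚᵘₚ.≤-Reasoning

  ι*⅟-cancelˡ : ∀ n x → ι (suc n) * (⅟ (suc n) * x) ≡ x
  ι*⅟-cancelˡ n x = trans (sym (ℚₚ.*-assoc (ι (suc n)) (⅟ (suc n)) x))
    (trans (cong (_* x) (ι*⅟ n)) (ℚₚ.*-identityˡ x))

  -- 1 / (L (L − 1) ⋯ (L − a + 1)), and 0 when a > L.
  R : ℕ → ℕ → ℚ
  R zero    L       = 1ℚ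
  R (suc a) zero    = 0ℚ
  R (suc a) (suc L) = ⅟ (suc L) * R a L

  falling : ℕ → ℕ → ℚ
  falling zero    L       = 1ℚ
  falling (suc a) zero    = 0ℚ
  falling (suc a) (suc L) = ι (suc L) * falling a L

  R≥0 : ∀ a L → 0ℚ ≤ R a L
  R≥0 zero    L       = 0≤1
  R≥0 (suc a) zero    = ℚₚ.≤-refl
  R≥0 (suc a) (suc L) = 0≤* (⅟≥0 (suc L)) (R≥0 a L)

  falling*R : ∀ {a L} → a ℕ.≤ L → falling a L * R a L ≡ 1ℚ
  falling*R ℕ.z≤n = refl
  falling*R {suc a} {suc L} (ℕ.s≤s a≤L) = begin-equality
    (ι (suc L) * falling a L) * (⅟ (suc L) * R a L)
      ≡⟨ solve 4 (λ x f y r → (x :* f) :* (y :* r) := (x :* y) :* (f :* r)) refl (ι (suc L)) (falling a L) (⅟ (suc L)) (R a L) ⟩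
    (ι (suc L) * ⅟ (suc L)) * (falling a L * R a L)
      ≡⟨ cong₂ _*_ (ι*⅟ L) (falling*R a≤L) ⟩
    1ℚ ∎
    where open ≤-Reasoning

  -- The definition peels off the largest factor; another arrival below a fixed maximum changes the
  -- smallest one.
  R-last : ∀ a L → R (suc a) L ≡ ⅟ (L ∸ a) * R a L
  R-last zero    zero    = refl
  R-last zero    (suc L) = refl
  R-last (suc a) zero    = refl
  R-last (suc a) (suc L) = trans (cong (⅟ (suc L) *_) (R-last a L))
    (solve 3 (λ x y r → x :* (y :* r) := y :* (x :* r)) refl (⅟ (suc L)) (⅟ (L ∸ a)) (R a L))

  -- With L = m + 1, the factor L - a counts the unseen values up to the maximum m after a arrivals;
  -- it cancels the smallest factor of `R (suc a) L`. For a ≥ L the left side is 0, hence an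
  -- inequality.
  R-shrink : ∀ a L → ι (L ∸ a) * R (suc a) L ≤ R a L
  R-shrink a L = subst (λ r → ι (L ∸ a) * r ≤ R a L) (sym (R-last a L)) (cancel (L ∸ a))
    where
    cancel : ∀ k → ι k * (⅟ k * R a L) ≤ R a L
    cancel zero    = subst (_≤ R a L) (sym (ℚₚ.*-zeroˡ (0ℚ * R a L))) (R≥0 a L)
    cancel (suc k) = ℚₚ.≤-reflexive (ι*⅟-cancelˡ k (R a L))

  -- All three terms are multiples of `R (suc a) (suc L)`, with coefficients a, L + 1 - a and L + 1.
  -- Read as a difference, it makes the weights of the possible next records telescope.
  R-telescope : ∀ {a L} → a ℕ.≤ L → ι a * R (suc a) (suc L) + R a (suc L) ≡ R a L
  R-telescope {a} {L} a≤L = begin-equality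
    ι a * r + R a (suc L)              ≡⟨ cong (λ x → ι a * r + x) (sym last) ⟩
    ι a * r + ι (suc (L ∸ a)) * r      ≡⟨ sym (ℚₚ.*-distribʳ-+ r (ι a) (ι (suc (L ∸ a)))) ⟩
    (ι a + ι (suc (L ∸ a))) * r        ≡⟨ cong (_* r) (sym (ι-+ a (suc (L ∸ a)))) ⟩
    ι (a ℕ.+ suc (L ∸ a)) * r          ≡⟨ cong (λ k → ι k * r) (trans (ℕₚ.+-suc a (L ∸ a)) (cong suc (ℕₚ.m+[n∸m]≡n a≤L))) ⟩
    ι (suc L) * r                      ≡⟨ ι*⅟-cancelˡ L (R a L) ⟩
    R a L ∎
    where
    open ≤-Reasoning
    r : ℚ
    r = R (suc a) (suc L)
    last : ι (suc (L ∸ a)) * r ≡ R a (suc L)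
    last = trans (cong (ι (suc (L ∸ a)) *_)
                   (trans (R-last a (suc L)) (cong (λ k → ⅟ k * R a (suc L)) (ℕₚ.+-∸-assoc 1 a≤L))))
                 (ι*⅟-cancelˡ (L ∸ a) (R a (suc L)))

  fac : ℕ → ℚ
  fac zero    = 1ℚ
  fac (suc k) = ι (suc k) * fac k

  fac≥0 : ∀ k → 0ℚ ≤ fac k
  fac≥0 zero    = 0≤1
  fac≥0 (suc k) = 0≤* (ι≥0 (suc k)) (fac≥0 k)

  fac*1/! : ∀ k → fac k * 1/ k ! ≡ 1ℚ
  fac*1/! zero    = refl
  fac*1/! (suc k) = begin-equality
    (ι (suc k) * fac k) * 1/ suc k !
      ≡⟨ cong ((ι (suc k) * fac k) *_) (ExpSumLemmas.fact-step k) ⟩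
    (ι (suc k) * fac k) * (⅟ (suc k) * 1/ k !)
      ≡⟨ solve 4 (λ x f y r → (x :* f) :* (y :* r) := (x :* y) :* (f :* r)) refl (ι (suc k)) (fac k) (⅟ (suc k)) (1/ k !) ⟩
    (ι (suc k) * ⅟ (suc k)) * (fac k * 1/ k !)
      ≡⟨ cong₂ _*_ (ι*⅟ k) (fac*1/! k) ⟩
    1ℚ ∎
    where open ≤-Reasoning

open RationalArithmetic

-- Sums of rationals over lists

module FiniteSums where
  open import Data.Rational.Base using (_+_; _*_; _≤_)
  open +-*-Solver

  private variable
    A B : Set

  ∑ : (A → ℚ) → List A → ℚ
  ∑ f []       = 0ℚ
  ∑ f (x ∷ xs) = f x + ∑ f xs

  ∑-congAll : ∀ {f g : A → ℚ} {xs} → All (λ x → f x ≡ g x) xs → ∑ f xs ≡ ∑ g xs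
  ∑-congAll []         = refl
  ∑-congAll (eq ∷ eqs) = cong₂ _+_ eq (∑-congAll eqs)

  ∑-cong : ∀ {f g : A → ℚ} → (∀ x → f x ≡ g x) → ∀ xs → ∑ f xs ≡ ∑ g xs
  ∑-cong f≗g xs = ∑-congAll (All.universal f≗g xs)

  ∑-mono : ∀ {f g : A → ℚ} {xs} → All (λ x → f x ≤ g x) xs → ∑ f xs ≤ ∑ g xs
  ∑-mono []       = ℚₚ.≤-refl
  ∑-mono (h ∷ hs) = ℚₚ.+-mono-≤ h (∑-mono hs)

  ∑-map : ∀ (f : B → ℚ) (g : A → B) xs → ∑ f (map g xs) ≡ ∑ (λ x → f (g x)) xs
  ∑-map f g []       = refl
  ∑-map f g (x ∷ xs) = cong (f (g x) +_) (∑-map f g xs)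

  ∑-++ : ∀ (f : A → ℚ) xs ys → ∑ f (xs ++ ys) ≡ ∑ f xs + ∑ f ys
  ∑-++ f []       ys = sym (ℚₚ.+-identityˡ _)
  ∑-++ f (x ∷ xs) ys = trans (cong (f x +_) (∑-++ f xs ys)) (sym (ℚₚ.+-assoc (f x) (∑ f xs) (∑ f ys)))

  ∑-concatMap : ∀ (f : B → ℚ) (g : A → List B) xs → ∑ f (concatMap g xs) ≡ ∑ (λ x → ∑ f (g x)) xs
  ∑-concatMap f g []       = refl
  ∑-concatMap f g (x ∷ xs) = trans (∑-++ f (g x) (concatMap g xs)) (cong (∑ f (g x) +_) (∑-concatMap f g xs))

  ∑-+ : ∀ (f g : A → ℚ) xs → ∑ (λ x → f x + g x) xs ≡ ∑ f xs + ∑ g xs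
  ∑-+ f g []       = refl
  ∑-+ f g (x ∷ xs) = trans (cong (f x + g x +_) (∑-+ f g xs))
    (solve 4 (λ a b c d → a :+ b :+ (c :+ d) := a :+ c :+ (b :+ d)) refl (f x) (g x) (∑ f xs) (∑ g xs))

  ∑-*ˡ : ∀ c (f : A → ℚ) xs → ∑ (λ x → c * f x) xs ≡ c * ∑ f xs
  ∑-*ˡ c f []       = sym (ℚₚ.*-zeroʳ c)
  ∑-*ˡ c f (x ∷ xs) = trans (cong (c * f x +_) (∑-*ˡ c f xs)) (sym (ℚₚ.*-distribˡ-+ c (f x) (∑ f xs)))

  ∑-const : ∀ c (xs : List A) → ∑ (λ _ → c) xs ≡ ι (length xs) * c
  ∑-const c []       = sym (ℚₚ.*-zeroˡ c)
  ∑-const c (x ∷ xs) = trans (cong (c +_) (∑-const c xs))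
    (solve 2 (λ k c → c :+ k :* c := (con 1ℚ :+ k) :* c) refl (ι (length xs)) c)

  ∑-0 : ∀ (xs : List A) → ∑ (λ _ → 0ℚ) xs ≡ 0ℚ
  ∑-0 []       = refl
  ∑-0 (x ∷ xs) = trans (ℚₚ.+-identityˡ _) (∑-0 xs)

  ∑-nonNeg : ∀ {f : A → ℚ} → (∀ x → 0ℚ ≤ f x) → ∀ xs → 0ℚ ≤ ∑ f xs
  ∑-nonNeg f≥0 []       = ℚₚ.≤-refl
  ∑-nonNeg f≥0 (x ∷ xs) = 0≤+ (f≥0 x) (∑-nonNeg f≥0 xs)

  ∑-↭ : ∀ (f : A → ℚ) {xs ys} → xs ↭ ys → ∑ f xs ≡ ∑ f ys
  ∑-↭ f ↭.refl         = refl
  ∑-↭ f (↭.prep x p)   = cong (f x +_) (∑-↭ f p)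
  ∑-↭ f (↭.swap {xs} x y p)   = trans (cong (λ s → f x + (f y + s)) (∑-↭ f p))
    (solve 3 (λ a b c → a :+ (b :+ c) := b :+ (a :+ c)) refl (f x) (f y) _)
  ∑-↭ f (↭.trans p q)  = trans (∑-↭ f p) (∑-↭ f q)

open FiniteSums

-- From a hidden set in random order to successive draws

module Arrangements where
  open import Data.Rational.Base using (_+_; _*_)
  open +-*-Solver

  private variable
    A : Set

  keep : A → A × List A → A × List A
  keep x (y , ys) = y , x ∷ ys

  picks : List A → List (A × List A)
  picks []       = []
  picks (x ∷ xs) = (x , xs) ∷ map (keep x) (picks xs)

  picks-↭ : ∀ (xs : List A) → All (λ (y , ys) → y ∷ ys ↭ xs) (picks xs)
  picks-↭ []       = []
  picks-↭ (x ∷ xs) = ↭.refl ∷ Allₚ.map⁺ (All.map (λ p → ↭.trans (↭.swap _ x ↭.refl) (↭.prep x p)) (picks-↭ xs))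

  ∑-picks : ∀ (f : A → ℚ) xs → ∑ (λ (y , _) → f y) (picks xs) ≡ ∑ f xs
  ∑-picks f []       = refl
  ∑-picks f (x ∷ xs) = cong (f x +_) (trans (∑-map _ _ (picks xs)) (∑-picks f xs))

  insertions-↭ : ∀ (x : A) ys → All (_↭ x ∷ ys) (insertions x ys)
  insertions-↭ x []       = ↭.refl ∷ []
  insertions-↭ x (y ∷ ys) = ↭.refl ∷
    Allₚ.map⁺ (All.map (λ p → ↭.trans (↭.prep y p) (↭.swap y x ↭.refl)) (insertions-↭ x ys))

  permutations-↭ : ∀ (xs : List A) → All (_↭ xs) (permutations xs)
  permutations-↭ []       = ↭.refl ∷ []
  permutations-↭ (x ∷ xs) = Allₚ.concat⁺ (Allₚ.map⁺ (All.map
    (λ {ys} p → All.map (λ q → ↭.trans q (↭.prep x p)) (insertions-↭ x ys)) (permutations-↭ xs)))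

  choose-All : ∀ {P : A → Set} n {xs} → All P xs → All (λ S → length S ≡ n × All P S) (choose n xs)
  choose-All zero    _          = (refl , []) ∷ []
  choose-All (suc n) []         = []
  choose-All (suc n) (px ∷ pxs) = Allₚ.++⁺
    (Allₚ.map⁺ (All.map (λ (eq , ps) → cong suc eq , px ∷ ps) (choose-All n pxs)))
    (choose-All (suc n) pxs)

  ∑arrangements : ℕ → List A → (List A → ℚ) → ℚ
  ∑arrangements zero    xs F = F []
  ∑arrangements (suc r) xs F = ∑ (λ (y , ys) → ∑arrangements r ys (λ π → F (y ∷ π))) (picks xs)

  ∑arr-cong : ∀ r (xs : List A) {F G} → (∀ π → F π ≡ G π) → ∑arrangements r xs F ≡ ∑arrangements r xs G
  ∑arr-cong zero    xs F≗G = F≗G []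
  ∑arr-cong (suc r) xs F≗G = ∑-cong (λ (y , ys) → ∑arr-cong r ys (λ π → F≗G (y ∷ π))) (picks xs)

  ∑arr-+ : ∀ r (xs : List A) F G →
    ∑arrangements r xs (λ π → F π + G π) ≡ ∑arrangements r xs F + ∑arrangements r xs G
  ∑arr-+ zero    xs F G = refl
  ∑arr-+ (suc r) xs F G = trans
    (∑-cong (λ (y , ys) → ∑arr-+ r ys (λ π → F (y ∷ π)) (λ π → G (y ∷ π))) (picks xs))
    (∑-+ _ _ (picks xs))

  ∑arr-*ˡ : ∀ r (xs : List A) c F → ∑arrangements r xs (λ π → c * F π) ≡ c * ∑arrangements r xs F
  ∑arr-*ˡ zero    xs c F = refl
  ∑arr-*ˡ (suc r) xs c F = trans
    (∑-cong (λ (y , ys) → ∑arr-*ˡ r ys c (λ π → F (y ∷ π))) (picks xs))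
    (∑-*ˡ c _ (picks xs))

  -- Regroups by the first arrival. Inserting x either puts it in front or keeps the first entry y
  -- of the old permutation there; the second case is a pick of y with x kept among the rest.
  ∑-permutations : ∀ (F : List A → ℚ) x xs → ∑ F (permutations (x ∷ xs)) ≡
    ∑ (λ (y , ys) → ∑ (λ π → F (y ∷ π)) (permutations ys)) (picks (x ∷ xs))
  ∑-permutations F x []       = solve 1 (λ a → a :+ con 0ℚ := a :+ con 0ℚ :+ con 0ℚ) refl (F [ x ])
  ∑-permutations {A} F x (z ∷ zs) = begin-equality
    ∑ F (permutations (x ∷ xs))
      ≡⟨ ∑-concatMap F (insertions x) (permutations xs) ⟩
    ∑ (λ π → ∑ F (insertions x π)) (permutations xs)
      ≡⟨ ∑-permutations (λ π → ∑ F (insertions x π)) z zs ⟩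
    ∑ (λ (y , ys) → ∑ (λ π → F (x ∷ y ∷ π) + ∑ F (map (y ∷_) (insertions x π))) (permutations ys)) (picks xs)
      ≡⟨ ∑-cong (λ (y , ys) → ∑-+ (λ π → F (x ∷ y ∷ π)) (λ π → ∑ F (map (y ∷_) (insertions x π))) (permutations ys)) (picks xs) ⟩
    ∑ (λ p → xFirst p + xLater p) (picks xs)
      ≡⟨ ∑-+ xFirst xLater (picks xs) ⟩
    ∑ xFirst (picks xs) + ∑ xLater (picks xs)
      ≡⟨ cong₂ _+_ (sym (∑-permutations (λ π → F (x ∷ π)) z zs)) (∑-cong regroup (picks xs)) ⟩
    ∑ (λ π → F (x ∷ π)) (permutations xs) + ∑ (λ p → startingWith (keep x p)) (picks xs)
      ≡⟨ cong (∑ (λ π → F (x ∷ π)) (permutations xs) +_) (sym (∑-map startingWith (keep x) (picks xs))) ⟩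
    ∑ startingWith (picks (x ∷ xs)) ∎
    where
    open ≤-Reasoning
    xs : List A
    xs = z ∷ zs
    startingWith xFirst xLater : A × List A → ℚ
    startingWith (y , ys) = ∑ (λ π → F (y ∷ π)) (permutations ys)
    xFirst (y , ys) = ∑ (λ π → F (x ∷ y ∷ π)) (permutations ys)
    xLater (y , ys) = ∑ (λ π → ∑ F (map (y ∷_) (insertions x π))) (permutations ys)
    regroup : ∀ p → xLater p ≡ startingWith (keep x p)
    regroup (y , ys) = trans (∑-cong (λ π → ∑-map F (y ∷_) (insertions x π)) (permutations ys))
      (sym (∑-concatMap (λ π → F (y ∷ π)) (insertions x) (permutations ys)))

  -- Double counting: a subset with a marked element is a marked element together with a subset of
  -- the others. The induction separates x marked, x chosen but unmarked, and x left out; `with-x`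
  -- merges the last two.
  ∑-choose-picks : ∀ (G : A → List A → ℚ) n xs →
    ∑ (λ S → ∑ (λ (y , ys) → G y ys) (picks S)) (choose (suc n) xs) ≡
    ∑ (λ (y , ys) → ∑ (G y) (choose n ys)) (picks xs)
  ∑-choose-picks G n []       = refl
  ∑-choose-picks G n (x ∷ xs) = begin-equality
    ∑ pickSum (map (x ∷_) (choose n xs) ++ choose (suc n) xs)
      ≡⟨ ∑-++ pickSum (map (x ∷_) (choose n xs)) (choose (suc n) xs) ⟩
    ∑ pickSum (map (x ∷_) (choose n xs)) + ∑ pickSum (choose (suc n) xs)
      ≡⟨ cong₂ _+_ (trans (∑-map pickSum (x ∷_) (choose n xs)) (∑-+ (G x) _ (choose n xs))) (∑-choose-picks G n xs) ⟩
    (∑ (G x) (choose n xs) + ∑ (λ S → ∑ (λ (y , ys) → G y ys) (map (keep x) (picks S))) (choose n xs))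
      + ∑ (λ (y , ys) → ∑ (G y) (choose n ys)) (picks xs)
      ≡⟨ ℚₚ.+-assoc (∑ (G x) (choose n xs)) _ _ ⟩
    ∑ (G x) (choose n xs) + (∑ (λ S → ∑ (λ (y , ys) → G y ys) (map (keep x) (picks S))) (choose n xs)
      + ∑ (λ (y , ys) → ∑ (G y) (choose n ys)) (picks xs))
      ≡⟨ cong (∑ (G x) (choose n xs) +_) (trans (with-x n) (sym (∑-map _ _ (picks xs)))) ⟩
    ∑ (λ (y , ys) → ∑ (G y) (choose n ys)) (picks (x ∷ xs)) ∎
    where
    open ≤-Reasoning
    pickSum : List _ → ℚ
    pickSum S = ∑ (λ (y , ys) → G y ys) (picks S)
    with-x : ∀ n →
      ∑ (λ S → ∑ (λ (y , ys) → G y ys) (map (keep x) (picks S))) (choose n xs)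
        + ∑ (λ (y , ys) → ∑ (G y) (choose n ys)) (picks xs) ≡
      ∑ (λ (y , ys) → ∑ (G y) (choose n (x ∷ ys))) (picks xs)
    with-x zero    = ℚₚ.+-identityˡ _
    with-x (suc n) = begin-equality
      ∑ (λ S → ∑ (λ (y , ys) → G y ys) (map (keep x) (picks S))) (choose (suc n) xs) + rest
        ≡⟨ cong (_+ rest) (trans (∑-cong (λ S → ∑-map _ _ (picks S)) (choose (suc n) xs))
             (∑-choose-picks (λ y ys → G y (x ∷ ys)) n xs)) ⟩
      ∑ (λ (y , ys) → ∑ (λ S → G y (x ∷ S)) (choose n ys)) (picks xs) + rest
        ≡⟨ sym (∑-+ _ _ (picks xs)) ⟩
      ∑ (λ (y , ys) → ∑ (λ S → G y (x ∷ S)) (choose n ys) + ∑ (G y) (choose (suc n) ys)) (picks xs)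
        ≡⟨ ∑-cong (λ (y , ys) → trans
             (cong (_+ ∑ (G y) (choose (suc n) ys)) (sym (∑-map (G y) (x ∷_) (choose n ys))))
             (sym (∑-++ (G y) (map (x ∷_) (choose n ys)) (choose (suc n) ys)))) (picks xs) ⟩
      ∑ (λ (y , ys) → ∑ (G y) (choose (suc n) (x ∷ ys))) (picks xs) ∎
      where
      rest = ∑ (λ (y , ys) → ∑ (G y) (choose (suc n) ys)) (picks xs)

  -- The marking identity applied n times, once per arrival. The right side no longer fixes the
  -- instance in advance, as backward induction over prefixes requires.
  ∑-choose-permutations : ∀ n (xs : List A) F →
    ∑ (λ S → ∑ F (permutations S)) (choose n xs) ≡ ∑arrangements n xs F
  ∑-choose-permutations zero    xs F = solve 1 (λ a → a :+ con 0ℚ :+ con 0ℚ := a) refl (F [])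
  ∑-choose-permutations (suc n) xs F = begin-equality
    ∑ (λ S → ∑ F (permutations S)) (choose (suc n) xs)
      ≡⟨ ∑-congAll (All.map (λ {S} (eq , _) → first S eq) (choose-All (suc n) (All.universal {P = λ x → x ≡ x} (λ _ → refl) xs))) ⟩
    ∑ (λ S → ∑ (λ (y , ys) → ∑ (λ π → F (y ∷ π)) (permutations ys)) (picks S)) (choose (suc n) xs)
      ≡⟨ ∑-choose-picks (λ y ys → ∑ (λ π → F (y ∷ π)) (permutations ys)) n xs ⟩
    ∑ (λ (y , ys) → ∑ (λ S → ∑ (λ π → F (y ∷ π)) (permutations S)) (choose n ys)) (picks xs)
      ≡⟨ ∑-cong (λ (y , ys) → ∑-choose-permutations n ys (λ π → F (y ∷ π))) (picks xs) ⟩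
    ∑arrangements (suc n) xs F ∎
    where
    open ≤-Reasoning
    first : ∀ S → length S ≡ suc n → ∑ F (permutations S) ≡
      ∑ (λ (y , ys) → ∑ (λ π → F (y ∷ π)) (permutations ys)) (picks S)
    first (x ∷ S) _ = ∑-permutations F x S

  -- Choosing a marked element first or last gives the absorption identity
  -- (a + 1) C(L, a + 1) = L C(L − 1, a), which replaces Pascal's rule here.
  ∑-choose-count : ∀ a (xs : List A) → fac a * ∑ (λ _ → 1ℚ) (choose a xs) ≡ falling a (length xs)
  ∑-choose-count zero    xs = refl
  ∑-choose-count (suc a) xs = begin-equality
    (ι (suc a) * fac a) * ∑ (λ _ → 1ℚ) (choose (suc a) xs)
      ≡⟨ solve 3 (λ i f s → (i :* f) :* s := f :* (i :* s)) refl (ι (suc a)) (fac a) _ ⟩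
    fac a * (ι (suc a) * ∑ (λ _ → 1ℚ) (choose (suc a) xs))
      ≡⟨ cong (fac a *_) (sym (∑-*ˡ (ι (suc a)) (λ _ → 1ℚ) (choose (suc a) xs))) ⟩
    fac a * ∑ (λ _ → ι (suc a) * 1ℚ) (choose (suc a) xs)
      ≡⟨ cong (fac a *_) (∑-congAll (All.map (λ {S} (eq , _) → mark S eq)
           (choose-All (suc a) (All.universal {P = λ x → x ≡ x} (λ _ → refl) xs)))) ⟩
    fac a * ∑ (λ S → ∑ (λ _ → 1ℚ) (picks S)) (choose (suc a) xs)
      ≡⟨ cong (fac a *_) (∑-choose-picks (λ _ _ → 1ℚ) a xs) ⟩
    fac a * ∑ (λ (y , ys) → ∑ (λ _ → 1ℚ) (choose a ys)) (picks xs)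
      ≡⟨ sym (∑-*ˡ (fac a) _ (picks xs)) ⟩
    ∑ (λ (y , ys) → fac a * ∑ (λ _ → 1ℚ) (choose a ys)) (picks xs)
      ≡⟨ ∑-cong (λ (y , ys) → ∑-choose-count a ys) (picks xs) ⟩
    ∑ (λ (y , ys) → falling a (length ys)) (picks xs)
      ≡⟨ shorter xs ⟩
    falling (suc a) (length xs) ∎
    where
    open ≤-Reasoning
    mark : ∀ S → length S ≡ suc a → ι (suc a) * 1ℚ ≡ ∑ (λ _ → 1ℚ) (picks S)
    mark S eq = trans (cong (λ k → ι k * 1ℚ) (sym eq)) (trans (sym (∑-const 1ℚ S)) (sym (∑-picks (λ _ → 1ℚ) S)))
    shorter : ∀ xs → ∑ (λ (y , ys) → falling a (length ys)) (picks xs) ≡ falling (suc a) (length xs)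
    shorter []       = refl
    shorter (x ∷ xs) = trans
      (∑-congAll (All.map (λ p → cong (λ k → falling a (ℕ.pred k)) (↭-length p)) (picks-↭ (x ∷ xs))))
      (trans (∑-picks (λ _ → falling a (length xs)) (x ∷ xs)) (∑-const (falling a (length xs)) (x ∷ xs)))

open Arrangements

-- Truncated exponentials against blocks of the harmonic series

module ExponentialBound where
  open import Data.Rational.Base using (_+_; _*_; _-_; _≤_)
  open +-*-Solver
  open PowerLemmas using () renaming (rational-^ to pow)

  private
    fact≥0 : ∀ n → 0ℚ ≤ 1/ n !
    fact≥0 n = ℚₚ.nonNegative⁻¹ _ {{ExpSumLemmas.fact-nonNeg n}}

  pow≥0 : ∀ {x} → 0ℚ ≤ x → ∀ n → 0ℚ ≤ pow x n
  pow≥0 0≤x zero    = 0≤1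
  pow≥0 0≤x (suc n) = 0≤* 0≤x (pow≥0 0≤x n)

  pow-mono : ∀ {x y} → 0ℚ ≤ x → x ≤ y → ∀ n → pow x n ≤ pow y n
  pow-mono 0≤x x≤y zero    = ℚₚ.≤-refl
  pow-mono 0≤x x≤y (suc n) = ℚₚ.≤-trans
    (*-monoʳ-≤ (pow≥0 0≤x n) x≤y) (*-monoˡ-≤ (ℚₚ.≤-trans 0≤x x≤y) (pow-mono 0≤x x≤y n))

  pow-1 : ∀ n → pow 1ℚ n ≡ 1ℚ
  pow-1 zero    = refl
  pow-1 (suc n) = trans (ℚₚ.*-identityˡ _) (pow-1 n)

  -- Mean value inequality for x ↦ xⁿ⁺¹.
  pow-increment : ∀ {x h} → 0ℚ ≤ x → 0ℚ ≤ h → ∀ n →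
    pow (x + h) (suc n) ≤ pow x (suc n) + ι (suc n) * (h * pow (x + h) n)
  pow-increment {x} {h} 0≤x 0≤h zero = ℚₚ.≤-reflexive
    (solve 2 (λ x h → (x :+ h) :* con 1ℚ := x :* con 1ℚ :+ (con 1ℚ :+ con 0ℚ) :* (h :* con 1ℚ)) refl x h)
  pow-increment {x} {h} 0≤x 0≤h (suc n) = begin
    (x + h) * q
      ≡⟨ ℚₚ.*-distribʳ-+ q x h ⟩
    x * q + h * q
      ≤⟨ ℚₚ.+-monoˡ-≤ (h * q) (*-monoˡ-≤ 0≤x (pow-increment 0≤x 0≤h n)) ⟩
    x * (pow x (suc n) + ι (suc n) * (h * p)) + h * q
      ≤⟨ ≤-slack (ι (suc n) * (h * (h * p)))
           (0≤* (ι≥0 (suc n)) (0≤* 0≤h (0≤* 0≤h (pow≥0 (0≤+ 0≤x 0≤h) n))))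
           (solve 5 (λ x h a i p → x :* (a :+ i :* (h :* p)) :+ h :* ((x :+ h) :* p) :+ i :* (h :* (h :* p))
              := x :* a :+ (con 1ℚ :+ i) :* (h :* ((x :+ h) :* p))) refl x h (pow x (suc n)) (ι (suc n)) p) ⟩
    x * pow x (suc n) + ι (suc (suc n)) * (h * q) ∎
    where
    open ≤-Reasoning
    p q : ℚ
    p = pow (x + h) n
    q = pow (x + h) (suc n)

  expPoly : ℕ → ℚ → ℚ
  expPoly zero    x = 1ℚ
  expPoly (suc N) x = expPoly N x + 1/ suc N ! * pow x (suc N)

  expPoly-0 : ∀ N → expPoly N 0ℚ ≡ 1ℚ
  expPoly-0 zero    = refl
  expPoly-0 (suc N) = trans (cong₂ _+_ (expPoly-0 N)
    (trans (cong (1/ suc N ! *_) (ℚₚ.*-zeroˡ (pow 0ℚ N))) (ℚₚ.*-zeroʳ (1/ suc N !)))) refl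

  expPoly-1 : ∀ N → expPoly N 1ℚ ≡ expSum N
  expPoly-1 zero    = refl
  expPoly-1 (suc N) = cong₂ _+_ (expPoly-1 N)
    (trans (cong (1/ suc N ! *_) (pow-1 (suc N))) (ℚₚ.*-identityʳ (1/ suc N !)))

  expPoly-mono : ∀ {x y} → 0ℚ ≤ x → x ≤ y → ∀ N → expPoly N x ≤ expPoly N y
  expPoly-mono 0≤x x≤y zero    = ℚₚ.≤-refl
  expPoly-mono 0≤x x≤y (suc N) = ℚₚ.+-mono-≤ (expPoly-mono 0≤x x≤y N)
    (*-monoˡ-≤ (fact≥0 (suc N)) (pow-mono 0≤x x≤y (suc N)))

  -- Mean value inequality, summed over the monomials: the derivative of `expPoly (suc N)` is
  -- `expPoly N`.
  expPoly-increment : ∀ {x h} → 0ℚ ≤ x → 0ℚ ≤ h → ∀ N →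
    expPoly (suc N) (x + h) ≤ expPoly (suc N) x + h * expPoly N (x + h)
  expPoly-increment {x} {h} 0≤x 0≤h zero = ℚₚ.≤-reflexive
    (solve 2 (λ x h → con 1ℚ :+ con 1ℚ :* ((x :+ h) :* con 1ℚ)
       := con 1ℚ :+ con 1ℚ :* (x :* con 1ℚ) :+ h :* con 1ℚ) refl x h)
  expPoly-increment {x} {h} 0≤x 0≤h (suc N) = begin
    expPoly (suc N) (x + h) + f′ * pow (x + h) (suc (suc N))
      ≤⟨ ℚₚ.+-mono-≤ (expPoly-increment 0≤x 0≤h N) (*-monoˡ-≤ (fact≥0 (suc (suc N))) (pow-increment 0≤x 0≤h (suc N))) ⟩
    (a + h * b) + f′ * (c + ι (suc (suc N)) * (h * d))
      ≡⟨ solve 7 (λ a h b f c i d → (a :+ h :* b) :+ f :* (c :+ i :* (h :* d))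
           := (a :+ f :* c) :+ h :* (b :+ (i :* f) :* d)) refl a h b f′ c (ι (suc (suc N))) d ⟩
    (a + f′ * c) + h * (b + (ι (suc (suc N)) * f′) * d)
      ≡⟨ cong (λ g → (a + f′ * c) + h * (b + g * d))
           (trans (cong (ι (suc (suc N)) *_) (ExpSumLemmas.fact-step (suc N))) (ι*⅟-cancelˡ (suc N) (1/ suc N !))) ⟩
    expPoly (suc (suc N)) x + h * expPoly (suc N) (x + h) ∎
    where
    open ≤-Reasoning
    f′ a b c d : ℚ
    f′ = 1/ suc (suc N) !
    a = expPoly (suc N) x
    b = expPoly N (x + h)
    c = pow x (suc (suc N))
    d = pow (x + h) (suc N)

  -- This is exp h ≤ 1 / (1 - h) for the truncated series, kept free of division. Raising the degree
  -- in the last summand only adds a nonnegative monomial.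
  expPoly-shift : ∀ {x h} → 0ℚ ≤ x → 0ℚ ≤ h → ∀ N →
    expPoly N (x + h) ≤ expPoly N x + h * expPoly N (x + h)
  expPoly-shift {x} {h} 0≤x 0≤h zero = ≤-slack (h * 1ℚ) (0≤* 0≤h 0≤1) refl
  expPoly-shift {x} {h} 0≤x 0≤h (suc N) = ℚₚ.≤-trans (expPoly-increment 0≤x 0≤h N)
    (ℚₚ.+-monoʳ-≤ (expPoly (suc N) x) (*-monoˡ-≤ 0≤h
      (≤-slack _ (0≤* (fact≥0 (suc N)) (pow≥0 (0≤+ 0≤x 0≤h) (suc N))) refl)))

  -- The recursion of `optimum` with its maximum replaced by 1, so that the two agree term by term
  -- during the first phase.
  harmonicBlock : ℕ → ℕ → ℚ
  harmonicBlock i zero    = 0ℚ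
  harmonicBlock i (suc r) = harmonicBlock (suc i) r + ⅟ i

  harmonicBlock≥0 : ∀ i r → 0ℚ ≤ harmonicBlock i r
  harmonicBlock≥0 i zero    = ℚₚ.≤-refl
  harmonicBlock≥0 i (suc r) = 0≤+ (harmonicBlock≥0 (suc i) r) (⅟≥0 i)

  -- exp (1/k) ≤ k/(k − 1), multiplied over k = j + 1, …, j + r.
  exp-harmonicBlock : ∀ N j r → ι j * expPoly N (harmonicBlock (suc j) r) ≤ ι (j ℕ.+ r)
  exp-harmonicBlock N j zero = ℚₚ.≤-reflexive
    (trans (cong (ι j *_) (expPoly-0 N)) (trans (ℚₚ.*-identityʳ (ι j)) (cong ι (sym (ℕₚ.+-identityʳ j)))))
  exp-harmonicBlock N j (suc r) = begin
    ι j * E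
      ≤⟨ ≤-slack (ι (suc j) * (E₀ + h * E - E)) (0≤* (ι≥0 (suc j)) (0≤q-p (expPoly-shift (harmonicBlock≥0 _ r) (⅟≥0 (suc j)) N)))
           refl ⟩
    ι j * E + ι (suc j) * (E₀ + h * E - E)
      ≡⟨ solve 4 (λ i e e₀ h → i :* e :+ (con 1ℚ :+ i) :* (e₀ :+ h :* e :- e)
           := (con 1ℚ :+ i) :* e₀ :+ ((con 1ℚ :+ i) :* h) :* e :- e) refl (ι j) E E₀ h ⟩
    ι (suc j) * E₀ + (ι (suc j) * h) * E - E
      ≡⟨ cong (λ g → ι (suc j) * E₀ + g * E - E) (ι*⅟ j) ⟩
    ι (suc j) * E₀ + 1ℚ * E - E
      ≡⟨ solve 2 (λ a e → a :+ con 1ℚ :* e :- e := a) refl (ι (suc j) * E₀) E ⟩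
    ι (suc j) * E₀
      ≤⟨ exp-harmonicBlock N (suc j) r ⟩
    ι (suc j ℕ.+ r)
      ≡⟨ cong ι (sym (ℕₚ.+-suc j r)) ⟩
    ι (j ℕ.+ suc r) ∎
    where
    open ≤-Reasoning
    h E E₀ : ℚ
    h = ⅟ (suc j)
    E = expPoly N (harmonicBlock (suc j) (suc r))
    E₀ = expPoly N (harmonicBlock (suc (suc j)) r)

open ExponentialBound

-- The rank-based stopping recursion and its 1/e bound

module OptimalValue where
  open import Data.Rational.Base using (_+_; _*_; _≤_; _⊔_)
  open +-*-Solver

  -- n/i times the optimal winning probability of the rank-based secretary
  -- problem with n = i + r items after i rejections.
  optimum : ℕ → ℕ → ℚ
  optimum i zero    = 0ℚ
  optimum i (suc r) = optimum (suc i) r + ⅟ i * (1ℚ ⊔ optimum (suc i) r)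

  0≤1⊔ : ∀ q → 0ℚ ≤ 1ℚ ⊔ q
  0≤1⊔ q = ℚₚ.≤-trans 0≤1 (ℚₚ.p≤p⊔q 1ℚ q)

  optimum≥0 : ∀ i r → 0ℚ ≤ optimum i r
  optimum≥0 i zero    = ℚₚ.≤-refl
  optimum≥0 i (suc r) = 0≤+ (optimum≥0 (suc i) r) (0≤* (⅟≥0 i) (0≤1⊔ (optimum (suc i) r)))

  optimum-below : ∀ i r → optimum (suc i) r ≤ 1ℚ → optimum i (suc r) ≡ optimum (suc i) r + ⅟ i
  optimum-below i r ≤1 = cong (optimum (suc i) r +_)
    (trans (cong (⅟ i *_) (ℚₚ.p≥q⇒p⊔q≡p ≤1)) (ℚₚ.*-identityʳ (⅟ i)))

  inv≥0 : ∀ q (1≤q : 1ℚ ≤ q) → 0ℚ ≤ inv q 1≤q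
  inv≥0 q 1≤q = ℚₚ.<⇒≤ (ℚₚ.positive⁻¹ (inv q 1≤q) {{InverseLemmas.inv-pos q 1≤q}})

  -- The optimal rule skips a first phase: optimum is a harmonic sum while it
  -- is below 1, and i * optimum i is constant afterwards.
  optimum-phases : ∀ N (1≤E : 1ℚ ≤ expSum N) j r →
    (optimum (suc j) r ≤ 1ℚ × optimum (suc j) r ≡ harmonicBlock (suc j) r) ⊎
    (1ℚ ≤ optimum (suc j) r × ι (suc j) * optimum (suc j) r ≤ ι 2 + ι (j ℕ.+ r) * inv (expSum N) 1≤E)
  optimum-phases N 1≤E j zero = inj₁ (0≤1 , refl)
  optimum-phases N 1≤E j (suc r) with optimum-phases N 1≤E (suc j) r
  ... | inj₂ (1≤φ , bound) = inj₂
      ( ℚₚ.≤-trans 1≤φ (≤-slack _ (0≤* (⅟≥0 (suc j)) (0≤1⊔ φ)) refl)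
      , (begin
        ι (suc j) * (φ + ⅟ (suc j) * (1ℚ ⊔ φ))
          ≡⟨ cong (λ m → ι (suc j) * (φ + ⅟ (suc j) * m)) (ℚₚ.p≤q⇒p⊔q≡q 1≤φ) ⟩
        ι (suc j) * (φ + ⅟ (suc j) * φ)
          ≡⟨ ℚₚ.*-distribˡ-+ (ι (suc j)) φ (⅟ (suc j) * φ) ⟩
        ι (suc j) * φ + ι (suc j) * (⅟ (suc j) * φ)
          ≡⟨ cong (ι (suc j) * φ +_) (ι*⅟-cancelˡ j φ) ⟩
        ι (suc j) * φ + φ
          ≡⟨ solve 2 (λ i f → i :* f :+ f := (con 1ℚ :+ i) :* f) refl (ι (suc j)) φ ⟩
        ι (suc (suc j)) * φ
          ≤⟨ bound ⟩
        ι 2 + ι (suc j ℕ.+ r) * I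
          ≡⟨ cong (λ k → ι 2 + ι k * I) (sym (ℕₚ.+-suc j r)) ⟩
        ι 2 + ι (j ℕ.+ suc r) * I ∎))
    where
    open ≤-Reasoning
    φ I : ℚ
    φ = optimum (suc (suc j)) r
    I = inv (expSum N) 1≤E
  ... | inj₁ (φ≤1 , φ≡) with ℚₚ.≤-total (optimum (suc j) (suc r)) 1ℚ
  ...   | inj₁ ≤1 = inj₁ (≤1 , trans (optimum-below (suc j) r φ≤1) (cong (_+ ⅟ (suc j)) φ≡))
  ...   | inj₂ 1≤ = inj₂ (1≤ , (begin
        ι (suc j) * optimum (suc j) (suc r)
          ≡⟨ cong (ι (suc j) *_) (optimum-below (suc j) r φ≤1) ⟩
        ι (suc j) * (φ + ⅟ (suc j))
          ≡⟨ ℚₚ.*-distribˡ-+ (ι (suc j)) φ (⅟ (suc j)) ⟩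
        ι (suc j) * φ + ι (suc j) * ⅟ (suc j)
          ≡⟨ cong (ι (suc j) * φ +_) (ι*⅟ j) ⟩
        ι (suc j) * φ + 1ℚ
          ≤⟨ ℚₚ.+-monoˡ-≤ 1ℚ (*-monoˡ-≤ (ι≥0 (suc j)) φ≤1) ⟩
        ι (suc j) * 1ℚ + 1ℚ
          -- The constant 2: one unit from j + 1 in place of j, one from the last reciprocal, which
          -- carries the sum past 1.
          ≡⟨ solve 1 (λ j → (con 1ℚ :+ j) :* con 1ℚ :+ con 1ℚ := (con 1ℚ :+ (con 1ℚ :+ con 0ℚ)) :+ j) refl (ι j) ⟩
        ι 2 + ι j
          ≡⟨ cong (ι 2 +_) (trans (sym (ℚₚ.*-identityʳ (ι j))) (cong (ι j *_) (sym (InverseLemmas.inv-inverseʳ (expSum N) 1≤E)))) ⟩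
        ι 2 + ι j * (expSum N * I)
          ≡⟨ cong (ι 2 +_) (sym (ℚₚ.*-assoc (ι j) (expSum N) I)) ⟩
        ι 2 + (ι j * expSum N) * I
          ≤⟨ ℚₚ.+-monoʳ-≤ (ι 2) (*-monoʳ-≤ (inv≥0 (expSum N) 1≤E) threshold) ⟩
        ι 2 + ι (j ℕ.+ suc r) * I ∎))
    where
    open ≤-Reasoning
    φ I : ℚ
    φ = optimum (suc (suc j)) r
    I = inv (expSum N) 1≤E
    ≡block : optimum (suc j) (suc r) ≡ harmonicBlock (suc j) (suc r)
    ≡block = trans (optimum-below (suc j) r φ≤1) (cong (_+ ⅟ (suc j)) φ≡)
    -- The block has reached 1, and `expPoly N` at 1 is `expSum N`. So the change of phase lies at
    -- about a fraction 1/e of the items.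
    threshold : ι j * expSum N ≤ ι (j ℕ.+ suc r)
    threshold = ℚₚ.≤-trans
      (*-monoˡ-≤ (ι≥0 j) (subst (_≤ expPoly N (harmonicBlock (suc j) (suc r))) (expPoly-1 N)
        (expPoly-mono 0≤1 (subst (1ℚ ≤_) ≡block 1≤) N)))
      (exp-harmonicBlock N j (suc r))

  -- The left side is n times the optimal winning probability for n = r + 1 items: the first arrival
  -- is always a record, with value 1 if accepted and `optimum 1 r` if rejected.
  1⊔optimum-bound : ∀ N (1≤E : 1ℚ ≤ expSum N) r →
    1ℚ ⊔ optimum 1 r ≤ ι 2 + ι r * inv (expSum N) 1≤E
  1⊔optimum-bound N 1≤E r with optimum-phases N 1≤E 0 r
  ... | inj₁ (≤1 , _) = begin
    1ℚ ⊔ optimum 1 r    ≡⟨ ℚₚ.p≥q⇒p⊔q≡p ≤1 ⟩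
    1ℚ                  ≤⟨ ι-mono {1} {2} (ℕ.s≤s ℕ.z≤n) ⟩
    ι 2                 ≤⟨ ≤-slack (ι r * I) (0≤* (ι≥0 r) (inv≥0 (expSum N) 1≤E)) refl ⟩
    ι 2 + ι r * I ∎
    where
    open ≤-Reasoning
    I : ℚ
    I = inv (expSum N) 1≤E
  ... | inj₂ (1≤ , bound) = begin
    1ℚ ⊔ optimum 1 r    ≡⟨ ℚₚ.p≤q⇒p⊔q≡q 1≤ ⟩
    optimum 1 r         ≡⟨ sym (ℚₚ.*-identityˡ (optimum 1 r)) ⟩
    ι 1 * optimum 1 r   ≤⟨ bound ⟩
    ι 2 + ι r * inv (expSum N) 1≤E ∎
    where open ≤-Reasoning

open OptimalValue

-- Divergence of the harmonic series

module Harmonic where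
  open import Data.Rational.Base using (_+_; _*_; _≤_; _<_)
  open +-*-Solver

  harmonic : ℕ → ℚ
  harmonic zero    = 0ℚ
  harmonic (suc k) = ⅟ (suc k) + harmonic k

  harmonic≥0 : ∀ k → 0ℚ ≤ harmonic k
  harmonic≥0 zero    = ℚₚ.≤-refl
  harmonic≥0 (suc k) = 0≤+ (⅟≥0 (suc k)) (harmonic≥0 k)

  harmonic-+ : ∀ {c} b k → b ℕ.+ k ℕ.≤ suc c → ι b * ⅟ (suc c) + harmonic k ≤ harmonic (b ℕ.+ k)
  harmonic-+ {c} zero    k _ = ℚₚ.≤-reflexive (trans (cong (_+ harmonic k) (ℚₚ.*-zeroˡ (⅟ (suc c)))) (ℚₚ.+-identityˡ _))
  harmonic-+ {c} (suc b) k (ℕ.s≤s b+k≤c) = begin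
    (1ℚ + ι b) * ⅟ (suc c) + harmonic k
      ≡⟨ solve 3 (λ b u h → (con 1ℚ :+ b) :* u :+ h := u :+ (b :* u :+ h)) refl (ι b) (⅟ (suc c)) (harmonic k) ⟩
    ⅟ (suc c) + (ι b * ⅟ (suc c) + harmonic k)
      ≤⟨ ℚₚ.+-mono-≤ (ExpSumLemmas.unit-antitone b+k≤c) (harmonic-+ b k (ℕₚ.m≤n⇒m≤1+n b+k≤c)) ⟩
    ⅟ (suc (b ℕ.+ k)) + harmonic (b ℕ.+ k) ∎
    where open ≤-Reasoning

  -- Oresme's argument: k + 1 further terms, each at least 1 / (2 (k + 1)).
  harmonic-double : ∀ k → ½ + harmonic (suc k) ≤ harmonic (suc k ℕ.+ suc k)
  harmonic-double k = ℚₚ.≤-trans (ℚₚ.≤-reflexive (cong (_+ harmonic (suc k)) half))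
    (harmonic-+ (suc k) (suc k) ℕₚ.≤-refl)
    where
    c = k ℕ.+ suc k
    half : ½ ≡ ι (suc k) * ⅟ (suc c)
    half = begin-equality
      ½                                    ≡⟨ sym (ℚₚ.*-identityʳ ½) ⟩
      ½ * 1ℚ                               ≡⟨ cong (½ *_) (sym (ι*⅟ c)) ⟩
      ½ * (ι (suc k ℕ.+ suc k) * ⅟ (suc c)) ≡⟨ cong (λ x → ½ * (x * ⅟ (suc c))) (ι-+ (suc k) (suc k)) ⟩
      ½ * ((ι (suc k) + ι (suc k)) * ⅟ (suc c))
        ≡⟨ solve 2 (λ x y → con ½ :* ((x :+ x) :* y) := x :* y) refl (ι (suc k)) (⅟ (suc c)) ⟩
      ι (suc k) * ⅟ (suc c) ∎
      where open ≤-Reasoning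

  harmonic-doublings : ∀ t k → ∃ λ d → ι t * ½ + harmonic (suc k) ≤ harmonic (d ℕ.+ suc k)
  harmonic-doublings zero    k = 0 , ℚₚ.≤-reflexive (ℚₚ.+-identityˡ (harmonic (suc k)))
  harmonic-doublings (suc t) k =
    let (d , h) = harmonic-doublings t k
        s = d ℕ.+ k
        eq : suc s ≡ d ℕ.+ suc k
        eq = sym (ℕₚ.+-suc d k)
    in suc s ℕ.+ d , (begin
      (1ℚ + ι t) * ½ + harmonic (suc k)
        ≡⟨ solve 2 (λ t h → (con 1ℚ :+ t) :* con ½ :+ h := con ½ :+ (t :* con ½ :+ h)) refl (ι t) (harmonic (suc k)) ⟩
      ½ + (ι t * ½ + harmonic (suc k))     ≤⟨ ℚₚ.+-monoʳ-≤ ½ h ⟩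
      ½ + harmonic (d ℕ.+ suc k)           ≡⟨ cong (λ x → ½ + harmonic x) (sym eq) ⟩
      ½ + harmonic (suc s)                 ≤⟨ harmonic-double s ⟩
      harmonic (suc s ℕ.+ suc s)           ≡⟨ cong (λ x → harmonic (suc s ℕ.+ x)) eq ⟩
      harmonic (suc s ℕ.+ (d ℕ.+ suc k))   ≡⟨ cong harmonic (sym (ℕₚ.+-assoc (suc s) d (suc k))) ⟩
      harmonic (suc s ℕ.+ d ℕ.+ suc k) ∎)
    where open ≤-Reasoning

  ι-unbounded : ∀ {B} → 0ℚ < B → ∃ λ t → B ≤ ι t
  ι-unbounded {B} 0<B =
    let (δ , 0<δ , Bδ≡1) = ArithmeticLemmas.divide 0<B (ℚₚ.positive⁻¹ 1ℚ)
        (t , 1/t<δ) = ExpSumLemmas.archimedean δ 0<δ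
    in suc t , (begin
      B                                  ≡⟨ sym (ι*⅟-cancelˡ t B) ⟩
      ι (suc t) * (⅟ (suc t) * B)        ≤⟨ *-monoˡ-≤ (ι≥0 (suc t)) (*-monoʳ-≤ (ℚₚ.<⇒≤ 0<B) (ℚₚ.<⇒≤ 1/t<δ)) ⟩
      ι (suc t) * (δ * B)                ≡⟨ cong (ι (suc t) *_) (trans (ℚₚ.*-comm δ B) Bδ≡1) ⟩
      ι (suc t) * 1ℚ                     ≡⟨ ℚₚ.*-identityʳ (ι (suc t)) ⟩
      ι (suc t) ∎)
    where open ≤-Reasoning

  harmonic-unbounded : ∀ {B} → 0ℚ < B → ∀ k → ∃ λ d → B + harmonic (suc k) ≤ harmonic (d ℕ.+ suc k)
  harmonic-unbounded {B} 0<B k =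
    let (t , B+B≤t) = ι-unbounded {B + B} (ℚₚ.+-mono-< 0<B 0<B)
        (d , h) = harmonic-doublings t k
    in d , ℚₚ.≤-trans (ℚₚ.+-monoˡ-≤ (harmonic (suc k)) (begin
      B               ≡⟨ solve 1 (λ b → b := (b :+ b) :* con ½) refl B ⟩
      (B + B) * ½     ≤⟨ *-monoʳ-≤ (ℚₚ.nonNegative⁻¹ ½) B+B≤t ⟩
      ι t * ½ ∎)) h
    where open ≤-Reasoning

open Harmonic

-- Weights of partially revealed instances

module Prefixes where
  open import Data.Rational.Base using (_+_; _*_; _-_; _≤_; _<_)
  open +-*-Solver

  max : List ℕ → ℕ
  max = foldr ℕ._⊔_ 0

  max-↭ : ∀ {xs ys} → xs ↭ ys → max xs ≡ max ys
  max-↭ ↭.refl         = refl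
  max-↭ (↭.prep x p)   = cong (x ℕ.⊔_) (max-↭ p)
  max-↭ (↭.swap {xs} {ys} x y p) = trans (cong (λ k → x ℕ.⊔ (y ℕ.⊔ k)) (max-↭ p))
    (trans (sym (ℕₚ.⊔-assoc x y (max ys))) (trans (cong (ℕ._⊔ max ys) (ℕₚ.⊔-comm x y)) (ℕₚ.⊔-assoc y x (max ys))))
  max-↭ (↭.trans p q)  = trans (max-↭ p) (max-↭ q)

  max-lub : ∀ {m xs} → All (ℕ._≤ m) xs → max xs ℕ.≤ m
  max-lub []       = ℕ.z≤n
  max-lub (h ∷ hs) = ℕₚ.⊔-lub h (max-lub hs)

  ≤max : ∀ xs → All (ℕ._≤ max xs) xs
  ≤max []       = []
  ≤max (x ∷ xs) = ℕₚ.m≤m⊔n x (max xs) ∷ All.map (λ h → ℕₚ.≤-trans h (ℕₚ.m≤n⊔m x (max xs))) (≤max xs)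

  -- The shape of every bound on the next arrival y: one constant as long as y does not exceed the
  -- maximum m, and a function of y when it is a new record.
  stepAt : ℕ → ℚ → (ℕ → ℚ) → ℕ → ℚ
  stepAt m C B y = if ⌊ y ℕₚ.≤? m ⌋ then C else B y

  stepAt-≤ : ∀ {m C} B {y} → y ℕ.≤ m → stepAt m C B y ≡ C
  stepAt-≤ {m} B {y} y≤m with y ℕₚ.≤? m
  ... | yes _   = refl
  ... | no  y≰m = contradiction y≤m y≰m

  stepAt-> : ∀ {m C} B {y} → m ℕ.< y → stepAt m C B y ≡ B y
  stepAt-> {m} B {y} m<y with y ℕₚ.≤? m
  ... | yes y≤m = contradiction y≤m (ℕₚ.<⇒≱ m<y)
  ... | no  _   = refl

  ∑-stepAt-low : ∀ m C B k → k ℕ.≤ suc m → ∑ (stepAt m C B) (downFrom k) ≡ ι k * C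
  ∑-stepAt-low m C B zero    _         = sym (ℚₚ.*-zeroˡ C)
  ∑-stepAt-low m C B (suc k) (ℕ.s≤s k≤m) = trans
    (cong₂ _+_ (stepAt-≤ B k≤m) (∑-stepAt-low m C B k (ℕₚ.m≤n⇒m≤1+n k≤m)))
    (solve 2 (λ k c → c :+ k :* c := (con 1ℚ :+ k) :* c) refl (ι k) C)

  ∑-stepAt : ∀ m C B d → ∑ (stepAt m C B) (downFrom (d ℕ.+ suc m)) ≡
    ι (suc m) * C + ∑ (λ t → B (t ℕ.+ suc m)) (downFrom d)
  ∑-stepAt m C B zero    = trans (∑-stepAt-low m C B (suc m) ℕₚ.≤-refl) (sym (ℚₚ.+-identityʳ _))
  ∑-stepAt m C B (suc d) = trans
    (cong₂ _+_ (stepAt-> B (ℕₚ.m≤n+m (suc m) d)) (∑-stepAt m C B d))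
    (solve 3 (λ b c s → b :+ (c :+ s) := c :+ (b :+ s)) refl (B (d ℕ.+ suc m)) (ι (suc m) * C) _)

  -- The situation after i arrivals: p has been seen, with maximum m, and xs is
  -- what remains of {0, …, H − 1}.
  record Seen (H i : ℕ) (p : List ℕ) (m : ℕ) (xs : List ℕ) : Set where
    field
      count    : length p ≡ i
      split    : p ++ xs ↭ downFrom H
      ≤m       : All (ℕ._≤ m) p
      ≢m       : All (_≢ m) xs
      distinct : Unique xs
      m<H      : m ℕ.< H
  open Seen

  Unique-↭ : ∀ {xs ys : List ℕ} → xs ↭ ys → Unique xs → Unique ys
  Unique-↭ p = ↭ₛ.Unique-resp-↭ (setoid ℕ) (↭⇒↭ₛ p)

  downFrom-< : ∀ H → All (ℕ._< H) (downFrom H)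
  downFrom-< H = All.tabulate ∈-downFrom⁻

  module _ {H i p m xs y ys} (s : Seen H i p m xs) (y∷ys↭xs : y ∷ ys ↭ xs) where
    private
      count′ : length (p ∷ʳ y) ≡ suc i
      count′ = trans (length-++ p) (trans (ℕₚ.+-comm (length p) 1) (cong suc (count s)))
      split′ : (p ∷ʳ y) ++ ys ↭ downFrom H
      split′ = subst (_↭ downFrom H) (sym (∷ʳ-++ p y ys)) (↭.trans (++⁺ˡ p y∷ys↭xs) (split s))
      ≢m′ : All (_≢ m) (y ∷ ys)
      ≢m′ = All-resp-↭ (↭-sym y∷ys↭xs) (≢m s)
      distinct′ : Unique (y ∷ ys)
      distinct′ = Unique-↭ (↭-sym y∷ys↭xs) (distinct s)

    next≢m : y ≢ m
    next≢m = All.head ≢m′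

    next<H : y ℕ.< H
    next<H = All.head (All-resp-↭ (↭-sym y∷ys↭xs) (Allₚ.++⁻ʳ p (All-resp-↭ (↭-sym (split s)) (downFrom-< H))))

    see-lower : y ℕ.≤ m → Seen H (suc i) (p ∷ʳ y) m ys
    see-lower y≤m with distinct′
    ... | _ ∷ u = record { count = count′ ; split = split′ ; ≤m = Allₚ.∷ʳ⁺ (≤m s) y≤m
      ; ≢m = All.tail ≢m′ ; distinct = u ; m<H = m<H s }

    see-record : m ℕ.≤ y → Seen H (suc i) (p ∷ʳ y) y ys
    see-record m≤y with distinct′
    ... | y≢ ∷ u = record { count = count′ ; split = split′
      ; ≤m = Allₚ.∷ʳ⁺ (All.map (λ h → ℕₚ.≤-trans h m≤y) (≤m s)) ℕₚ.≤-refl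
      ; ≢m = All.map (λ ne eq → ne (sym eq)) y≢ ; distinct = u ; m<H = next<H }

  see-first : ∀ {H y ys} → y ∷ ys ↭ downFrom H → Seen H 1 [ y ] y ys
  see-first {H} {y} {ys} p with Unique-↭ (↭-sym p) (downFrom⁺ H)
  ... | y≢ ∷ u = record { count = refl ; split = p ; ≤m = ℕₚ.≤-refl ∷ []
    ; ≢m = All.map (λ ne eq → ne (sym eq)) y≢ ; distinct = u
    ; m<H = All.head (All-resp-↭ (↭-sym p) (downFrom-< H)) }

  module _ {H i p m xs} (s : Seen H i p m xs) where
    private
      d = H ∸ suc m

    -- The seen values are all at most m and contribute C each; adding them completes the sum to the
    -- full range. There is no subtraction because i ≤ m + 1 is itself deduced from this identity.
    ∑-stepAt-seen : ∀ C B → ∑ (stepAt m C B) xs + ι i * C ≡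
      ι (suc m) * C + ∑ (λ t → B (t ℕ.+ suc m)) (downFrom d)
    ∑-stepAt-seen C B = begin-equality
      ∑ f xs + ι i * C                ≡⟨ cong (λ k → ∑ f xs + ι k * C) (sym (count s)) ⟩
      ∑ f xs + ι (length p) * C       ≡⟨ cong (∑ f xs +_) (sym (trans (∑-congAll (All.map (stepAt-≤ B) (≤m s))) (∑-const C p))) ⟩
      ∑ f xs + ∑ f p                  ≡⟨ ℚₚ.+-comm (∑ f xs) (∑ f p) ⟩
      ∑ f p + ∑ f xs                  ≡⟨ sym (∑-++ f p xs) ⟩
      ∑ f (p ++ xs)                   ≡⟨ ∑-↭ f (split s) ⟩
      ∑ f (downFrom H)                ≡⟨ cong (λ k → ∑ f (downFrom k)) (sym (ℕₚ.m∸n+n≡m (m<H s))) ⟩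
      ∑ f (downFrom (d ℕ.+ suc m))    ≡⟨ ∑-stepAt m C B d ⟩
      ι (suc m) * C + ∑ (λ t → B (t ℕ.+ suc m)) (downFrom d) ∎
      where
      open ≤-Reasoning
      f = stepAt m C B

    -- Pigeonhole by summation: for C = 1 and B = 0 the identity counts the values up to m, seen or
    -- not, as m + 1.
    seen≤ : i ℕ.≤ suc m
    seen≤ = ι-cancel-≤ (begin
      ι i
        ≤⟨ ≤-slack (∑ (stepAt m 1ℚ (λ _ → 0ℚ)) xs) ∑≥0 refl ⟩
      ι i + ∑ (stepAt m 1ℚ (λ _ → 0ℚ)) xs
        ≡⟨ solve 2 (λ i s → i :+ s := s :+ i :* con 1ℚ) refl (ι i) _ ⟩
      ∑ (stepAt m 1ℚ (λ _ → 0ℚ)) xs + ι i * 1ℚ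
        ≡⟨ ∑-stepAt-seen 1ℚ (λ _ → 0ℚ) ⟩
      ι (suc m) * 1ℚ + ∑ (λ _ → 0ℚ) (downFrom d)
        ≡⟨ cong (ι (suc m) * 1ℚ +_) (∑-0 (downFrom d)) ⟩
      ι (suc m) * 1ℚ + 0ℚ
        ≡⟨ trans (ℚₚ.+-identityʳ _) (ℚₚ.*-identityʳ (ι (suc m))) ⟩
      ι (suc m) ∎)
      where
      open ≤-Reasoning
      indicator≥0 : ∀ y → 0ℚ ≤ stepAt m 1ℚ (λ _ → 0ℚ) y
      indicator≥0 y with y ℕₚ.≤? m
      ... | yes _ = 0≤1
      ... | no  _ = ℚₚ.≤-refl
      ∑≥0 : 0ℚ ≤ ∑ (stepAt m 1ℚ (λ _ → 0ℚ)) xs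
      ∑≥0 = ∑-nonNeg indicator≥0 xs

    ∑-stepAt-remaining : ∀ C B → ∑ (stepAt m C B) xs ≡
      ι (suc m ∸ i) * C + ∑ (λ t → B (t ℕ.+ suc m)) (downFrom d)
    ∑-stepAt-remaining C B = begin-equality
      S                                            ≡⟨ solve 3 (λ s i c → s := (s :+ i :* c) :- i :* c) refl S (ι i) C ⟩
      (S + ι i * C) - ι i * C                      ≡⟨ cong (_- ι i * C) (∑-stepAt-seen C B) ⟩
      (ι (suc m) * C + T) - ι i * C
        ≡⟨ cong (λ k → (k * C + T) - ι i * C) (trans (cong ι (sym (ℕₚ.m+[n∸m]≡n seen≤))) (ι-+ i (suc m ∸ i))) ⟩
      ((ι i + ι (suc m ∸ i)) * C + T) - ι i * C
        ≡⟨ solve 4 (λ i k c t → ((i :+ k) :* c :+ t) :- i :* c := k :* c :+ t) refl (ι i) (ι (suc m ∸ i)) C T ⟩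
      ι (suc m ∸ i) * C + T ∎
      where
      open ≤-Reasoning
      S T : ℚ
      S = ∑ (stepAt m C B) xs
      T = ∑ (λ t → B (t ℕ.+ suc m)) (downFrom d)

  ∑-R-telescope : ∀ {i L} → i ℕ.≤ L → ∀ d →
    ι i * ∑ (λ t → R (suc i) (suc (t ℕ.+ L))) (downFrom d) + R i (d ℕ.+ L) ≡ R i L
  ∑-R-telescope {i} {L} i≤L zero    = trans (cong (_+ R i L) (ℚₚ.*-zeroʳ (ι i))) (ℚₚ.+-identityˡ (R i L))
  ∑-R-telescope {i} {L} i≤L (suc d) = begin-equality
    ι i * (r + S) + R i (suc (d ℕ.+ L))
      ≡⟨ solve 4 (λ i r s t → i :* (r :+ s) :+ t := i :* s :+ (i :* r :+ t)) refl (ι i) r S (R i (suc (d ℕ.+ L))) ⟩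
    ι i * S + (ι i * r + R i (suc (d ℕ.+ L)))
      ≡⟨ cong (ι i * S +_) (R-telescope (ℕₚ.≤-trans i≤L (ℕₚ.m≤n+m L d))) ⟩
    ι i * S + R i (d ℕ.+ L)
      ≡⟨ ∑-R-telescope i≤L d ⟩
    R i L ∎
    where
    open ≤-Reasoning
    r S : ℚ
    r = R (suc i) (suc (d ℕ.+ L))
    S = ∑ (λ t → R (suc i) (suc (t ℕ.+ L))) (downFrom d)

  -- Source of the factor `⅟ i` in `optimum`: the total weight of the next records. The end term
  -- `R i (d + L)` left by the cut-off is nonnegative and is dropped.
  ∑-R-tail : ∀ {j L} → suc j ℕ.≤ L → ∀ d →
    ∑ (λ t → R (suc (suc j)) (suc (t ℕ.+ L))) (downFrom d) ≤ ⅟ (suc j) * R (suc j) L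
  ∑-R-tail {j} {L} i≤L d = begin
    S                           ≡⟨ sym (ι*⅟-cancelˡ j S) ⟩
    ι i * (⅟ i * S)             ≡⟨ solve 3 (λ a b s → a :* (b :* s) := b :* (a :* s)) refl (ι i) (⅟ i) S ⟩
    ⅟ i * (ι i * S)             ≤⟨ *-monoˡ-≤ (⅟≥0 i) (≤-slack (R i (d ℕ.+ L)) (R≥0 i (d ℕ.+ L)) (∑-R-telescope i≤L d)) ⟩
    ⅟ i * R i L ∎
    where
    open ≤-Reasoning
    i = suc j
    S : ℚ
    S = ∑ (λ t → R (suc i) (suc (t ℕ.+ L))) (downFrom d)

  indicator : ℕ → ℕ → ℚ
  indicator m y = if ⌊ m ℕₚ.≤? y ⌋ then 1ℚ else 0ℚ

  indicator-≤ : ∀ {m y} → m ℕ.≤ y → indicator m y ≡ 1ℚ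
  indicator-≤ {m} {y} m≤y with m ℕₚ.≤? y
  ... | yes _   = refl
  ... | no  m≰y = contradiction m≤y m≰y

  indicator-> : ∀ {m y} → y ℕ.< m → indicator m y ≡ 0ℚ
  indicator-> {m} {y} y<m with m ℕₚ.≤? y
  ... | yes m≤y = contradiction m≤y (ℕₚ.<⇒≱ y<m)
  ... | no  _   = refl

  -- The weight of all continuations by r elements of xs that leave y maximal,
  -- when the elements seen so far have maximum m.
  winWeight : (n r m y : ℕ) → List ℕ → ℚ
  winWeight n r m y xs = ∑arrangements r xs (λ π → R n (suc (m ℕ.⊔ max π)) * indicator (m ℕ.⊔ max π) y)

  winWeight-suc : ∀ n r m y xs →
    winWeight n (suc r) m y xs ≡ ∑ (λ (z , zs) → winWeight n r (m ℕ.⊔ z) y zs) (picks xs)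
  winWeight-suc n r m y xs = ∑-cong (λ (z , zs) → ∑arr-cong r zs (λ π →
    cong (λ k → R n (suc k) * indicator k y) (sym (ℕₚ.⊔-assoc m z (max π))))) (picks xs)

  winWeight-lost : ∀ n r {m y} xs → y ℕ.< m → winWeight n r m y xs ≡ 0ℚ
  winWeight-lost n r {m} {y} xs y<m = trans
    (∑arr-cong r xs {G = λ _ → 0ℚ * 0ℚ} (λ π → trans
      (cong (R n (suc (m ℕ.⊔ max π)) *_) (indicator-> (ℕₚ.<-≤-trans y<m (ℕₚ.m≤m⊔n m (max π)))))
      (ℚₚ.*-zeroʳ (R n (suc (m ℕ.⊔ max π))))))
    (trans (∑arr-*ˡ r xs 0ℚ (λ _ → 0ℚ)) (ℚₚ.*-zeroˡ (∑arrangements r xs (λ _ → 0ℚ))))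

  -- Only arrivals below m keep m maximal. There are m + 1 - i of them, and `R-shrink` trades this
  -- count for one factor of the weight, so the bound does not depend on r.
  winWeight-bound : ∀ {H i p m xs} r → Seen H i p m xs → winWeight (i ℕ.+ r) r m m xs ≤ R i (suc m)
  winWeight-bound {i = i} {m = m} zero s = ℚₚ.≤-reflexive (begin-equality
    R (i ℕ.+ 0) (suc (m ℕ.⊔ 0)) * indicator (m ℕ.⊔ 0) m
      ≡⟨ cong₂ (λ a b → R a (suc b) * indicator b m) (ℕₚ.+-identityʳ i) (ℕₚ.⊔-identityʳ m) ⟩
    R i (suc m) * indicator m m     ≡⟨ cong (R i (suc m) *_) (indicator-≤ {m} ℕₚ.≤-refl) ⟩
    R i (suc m) * 1ℚ                ≡⟨ ℚₚ.*-identityʳ (R i (suc m)) ⟩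
    R i (suc m) ∎)
    where open ≤-Reasoning
  winWeight-bound {H} {i} {p} {m} {xs} (suc r) s = begin
    winWeight n (suc r) m m xs
      ≡⟨ winWeight-suc n r m m xs ⟩
    ∑ (λ (z , zs) → winWeight n r (m ℕ.⊔ z) m zs) (picks xs)
      ≤⟨ ∑-mono (All.map (λ {(z , zs)} → term z zs) (picks-↭ xs)) ⟩
    ∑ (λ (z , _) → f z) (picks xs)
      ≡⟨ ∑-picks f xs ⟩
    ∑ f xs
      ≡⟨ ∑-stepAt-remaining s (R (suc i) (suc m)) (λ _ → 0ℚ) ⟩
    ι (suc m ∸ i) * R (suc i) (suc m) + ∑ (λ _ → 0ℚ) (downFrom (H ∸ suc m))
      ≡⟨ cong (ι (suc m ∸ i) * R (suc i) (suc m) +_) (∑-0 (downFrom (H ∸ suc m))) ⟩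
    ι (suc m ∸ i) * R (suc i) (suc m) + 0ℚ
      ≡⟨ ℚₚ.+-identityʳ _ ⟩
    ι (suc m ∸ i) * R (suc i) (suc m)
      ≤⟨ R-shrink i (suc m) ⟩
    R i (suc m) ∎
    where
    open ≤-Reasoning
    n = i ℕ.+ suc r
    f = stepAt m (R (suc i) (suc m)) (λ _ → 0ℚ)
    term : ∀ z zs → z ∷ zs ↭ xs → winWeight n r (m ℕ.⊔ z) m zs ≤ f z
    term z zs z∷zs↭xs with ℕₚ.≤-<-connex z m
    ... | inj₁ z≤m = begin
      winWeight n r (m ℕ.⊔ z) m zs
        ≡⟨ cong₂ (λ a b → winWeight a r b m zs) (ℕₚ.+-suc i r) (ℕₚ.m≥n⇒m⊔n≡m z≤m) ⟩
      winWeight (suc i ℕ.+ r) r m m zs  ≤⟨ winWeight-bound r (see-lower s z∷zs↭xs z≤m) ⟩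
      R (suc i) (suc m)                 ≡⟨ sym (stepAt-≤ (λ _ → 0ℚ) z≤m) ⟩
      f z ∎
    ... | inj₂ m<z = ℚₚ.≤-reflexive (trans
      (winWeight-lost n r zs (ℕₚ.<-≤-trans m<z (ℕₚ.m≤n⊔m m z))) (sym (stepAt-> (λ _ → 0ℚ) m<z)))

  -- The normalising constant

  totalWeight : ℕ → ℕ → ℚ
  totalWeight n H = ∑ (λ S → R n (suc (max S))) (choose n (downFrom H))

  totalWeight≥0 : ∀ n H → 0ℚ ≤ totalWeight n H
  totalWeight≥0 n H = ∑-nonNeg (λ S → R≥0 n (suc (max S))) (choose n (downFrom H))

  -- The new sets are those with maximum K. Up to the factor `fac a` there are `falling a K` of
  -- them, which cancels `R a K` and leaves mass 1 / (K + 1) on the maximum K.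
  totalWeight-suc : ∀ {a K} → a ℕ.≤ K →
    fac a * totalWeight (suc a) (suc K) ≡ ⅟ (suc K) + fac a * totalWeight (suc a) K
  totalWeight-suc {a} {K} a≤K = begin-equality
    fac a * ∑ w (map (K ∷_) (choose a (downFrom K)) ++ choose (suc a) (downFrom K))
      ≡⟨ cong (fac a *_) (∑-++ w (map (K ∷_) (choose a (downFrom K))) (choose (suc a) (downFrom K))) ⟩
    fac a * (∑ w (map (K ∷_) (choose a (downFrom K))) + T)
      ≡⟨ cong (λ x → fac a * (x + T)) (trans (∑-map w (K ∷_) (choose a (downFrom K)))
           (trans (∑-congAll (All.map (λ {S} (_ , S<K) → topped S S<K) (choose-All a (downFrom-< K))))
             (∑-*ˡ r (λ _ → 1ℚ) (choose a (downFrom K))))) ⟩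
    fac a * (r * c + T)
      ≡⟨ solve 4 (λ f r c t → f :* (r :* c :+ t) := (f :* c) :* r :+ f :* t) refl (fac a) r c T ⟩
    (fac a * c) * r + fac a * T
      ≡⟨ cong (λ x → x * r + fac a * T) (trans (∑-choose-count a (downFrom K)) (cong (falling a) (length-downFrom K))) ⟩
    falling a K * (⅟ (suc K) * R a K) + fac a * T
      ≡⟨ solve 4 (λ f u r t → f :* (u :* r) :+ t := u :* (f :* r) :+ t) refl (falling a K) (⅟ (suc K)) (R a K) (fac a * T) ⟩
    ⅟ (suc K) * (falling a K * R a K) + fac a * T
      ≡⟨ cong (λ x → ⅟ (suc K) * x + fac a * T) (falling*R a≤K) ⟩
    ⅟ (suc K) * 1ℚ + fac a * T
      ≡⟨ cong (_+ fac a * T) (ℚₚ.*-identityʳ (⅟ (suc K))) ⟩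
    ⅟ (suc K) + fac a * T ∎
    where
    open ≤-Reasoning
    w : List ℕ → ℚ
    w S = R (suc a) (suc (max S))
    T r c : ℚ
    T = totalWeight (suc a) K
    r = R (suc a) (suc K)
    c = ∑ (λ _ → 1ℚ) (choose a (downFrom K))
    topped : ∀ S → All (ℕ._< K) S → w (K ∷ S) ≡ r * 1ℚ
    topped S S<K = trans (cong (λ k → R (suc a) (suc k)) (ℕₚ.m≥n⇒m⊔n≡m (max-lub (All.map ℕₚ.<⇒≤ S<K))))
      (sym (ℚₚ.*-identityʳ r))

  -- Sums the masses 1 / (K + 1) from K = a on, since a + 1 elements need a maximum of at least a.
  -- The missing initial terms form the loss `harmonic a`.
  totalWeight-bound : ∀ a d → harmonic (d ℕ.+ a) ≤ fac a * totalWeight (suc a) (d ℕ.+ a) + harmonic a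
  totalWeight-bound a zero    = ℚₚ.≤-trans (ℚₚ.≤-reflexive (sym (ℚₚ.+-identityˡ (harmonic a))))
    (ℚₚ.+-monoˡ-≤ (harmonic a) (0≤* (fac≥0 a) (totalWeight≥0 (suc a) a)))
  totalWeight-bound a (suc d) = begin
    ⅟ (suc K) + harmonic K
      ≤⟨ ℚₚ.+-monoʳ-≤ (⅟ (suc K)) (totalWeight-bound a d) ⟩
    ⅟ (suc K) + (fac a * totalWeight (suc a) K + harmonic a)
      ≡⟨ sym (ℚₚ.+-assoc (⅟ (suc K)) (fac a * totalWeight (suc a) K) (harmonic a)) ⟩
    ⅟ (suc K) + fac a * totalWeight (suc a) K + harmonic a
      ≡⟨ cong (_+ harmonic a) (sym (totalWeight-suc (ℕₚ.m≤n+m a d))) ⟩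
    fac a * totalWeight (suc a) (suc K) + harmonic a ∎
    where
    open ≤-Reasoning
    K = d ℕ.+ a

open Prefixes
open import Defs

-- Cauchy reals against rational bounds

module RealBounds where
  open +-*-Solver
  open ArithmeticLemmas using (½>0; ½+½; eventually-bounded; divide)
  open ExpSumLemmas using (archimedean; unit-antitone)

  ≤⇒0≤- : ∀ {x y} → x ≤ y → 0ℝ ≤ y - x
  ≤⇒0≤- {x} {y} x≤y = mk≤ λ ε ε>0 → let (N , h) = x≤y+ε x≤y ε ε>0 in
    N , λ n n≥ → subst (0ℚ ℚ.≤_)
      (solve 3 (λ x y e → y :+ e :- x := y :- x :+ e) refl (seq x n) (seq y n) ε)
      (0≤q-p (h n n≥))

  fromℚ-nonNeg : ∀ {q} → 0ℚ ℚ.≤ q → 0ℝ ≤ fromℚ q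
  fromℚ-nonNeg 0≤q = mk≤ λ ε ε>0 → 0 , λ n _ → 0≤+ 0≤q (ℚₚ.<⇒≤ ε>0)

  ≤-fromℚ : ∀ {x p q} → x ≤ fromℚ p → p ℚ.≤ q → x ≤ fromℚ q
  ≤-fromℚ x≤p p≤q = mk≤ λ ε ε>0 → let (N , h) = x≤y+ε x≤p ε ε>0 in
    N , λ n n≥ → ℚₚ.≤-trans (h n n≥) (ℚₚ.+-monoˡ-≤ ε p≤q)

  p≤∣p∣ : ∀ p → p ℚ.≤ ℚ.∣ p ∣
  p≤∣p∣ p with ℚₚ.≤-total 0ℚ p
  ... | inj₁ 0≤p = ℚₚ.≤-reflexive (sym (ℚₚ.0≤p⇒∣p∣≡p 0≤p))
  ... | inj₂ p≤0 = ℚₚ.≤-trans p≤0 (ℚₚ.0≤∣p∣ p)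

  -- Approximations u, v of nonnegative reals may be negative, but eventually exceed -η. Expanding
  -- (u + η)(v + η) ≥ 0 leaves an error (u + v + η) η, controlled by the bounds A and B of the
  -- sequences and η ≤ 1.
  *-nonNeg : ∀ {x y} → 0ℝ ≤ x → 0ℝ ≤ y → 0ℝ ≤ x * y
  *-nonNeg {x} {y} 0≤x 0≤y = mk≤ λ ε ε>0 →
    let (A , A>0 , N₁ , a)  = eventually-bounded (seq x) (cauchy x)
        (B , B>0 , N₂ , b)  = eventually-bounded (seq y) (cauchy y)
        (δ , δ>0 , Kδ≡ε)    = divide (ℚₚ.+-mono-< (ℚₚ.+-mono-< A>0 B>0) (ℚₚ.positive⁻¹ 1ℚ)) ε>0
        (t , η<δ)           = archimedean δ δ>0
        η>0                 = ℚₚ.positive⁻¹ _ {{ExpSumLemmas.unit-pos (suc t)}}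
        (N₃ , p)            = x≤y+ε 0≤x (⅟ (suc t)) η>0
        (N₄ , q)            = x≤y+ε 0≤y (⅟ (suc t)) η>0
    in (N₁ ℕ.⊔ N₂) ℕ.⊔ (N₃ ℕ.⊔ N₄) , λ n n≥ →
      let n₁₂ = ℕₚ.m⊔n≤o⇒m≤o (N₁ ℕ.⊔ N₂) (N₃ ℕ.⊔ N₄) n≥
          n₃₄ = ℕₚ.m⊔n≤o⇒n≤o (N₁ ℕ.⊔ N₂) (N₃ ℕ.⊔ N₄) n≥
      in combine (seq x n) (seq y n) A B δ (⅟ (suc t)) Kδ≡ε
           (ℚₚ.+-mono-< (ℚₚ.+-mono-< A>0 B>0) (ℚₚ.positive⁻¹ 1ℚ))
           (ℚₚ.<⇒≤ η>0) (ℚₚ.<⇒≤ η<δ) (unit-antitone {0} {t} ℕ.z≤n)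
           (ℚₚ.≤-trans (p≤∣p∣ _) (a n (ℕₚ.m⊔n≤o⇒m≤o N₁ N₂ n₁₂)))
           (ℚₚ.≤-trans (p≤∣p∣ _) (b n (ℕₚ.m⊔n≤o⇒n≤o N₁ N₂ n₁₂)))
           (p n (ℕₚ.m⊔n≤o⇒m≤o N₃ N₄ n₃₄)) (q n (ℕₚ.m⊔n≤o⇒n≤o N₃ N₄ n₃₄))
    where
    open ≤-Reasoning
    combine : ∀ u v A B δ η {ε} → (A ℚ.+ B ℚ.+ 1ℚ) ℚ.* δ ≡ ε → 0ℚ ℚ.< A ℚ.+ B ℚ.+ 1ℚ →
      0ℚ ℚ.≤ η → η ℚ.≤ δ → η ℚ.≤ 1ℚ → u ℚ.≤ A → v ℚ.≤ B →
      0ℚ ℚ.≤ u ℚ.+ η → 0ℚ ℚ.≤ v ℚ.+ η → 0ℚ ℚ.≤ u ℚ.* v ℚ.+ ε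
    combine u v A B δ η {ε} Kδ≡ε K>0 0≤η η≤δ η≤1 u≤A v≤B 0≤u+η 0≤v+η = begin
      0ℚ                                      ≤⟨ 0≤* 0≤u+η 0≤v+η ⟩
      (u ℚ.+ η) ℚ.* (v ℚ.+ η)                 ≡⟨ solve 3 (λ u v h → (u :+ h) :* (v :+ h) := u :* v :+ (u :+ v :+ h) :* h) refl u v η ⟩
      u ℚ.* v ℚ.+ (u ℚ.+ v ℚ.+ η) ℚ.* η       ≤⟨ ℚₚ.+-monoʳ-≤ (u ℚ.* v) (*-monoʳ-≤ 0≤η (ℚₚ.+-mono-≤ (ℚₚ.+-mono-≤ u≤A v≤B) η≤1)) ⟩
      u ℚ.* v ℚ.+ (A ℚ.+ B ℚ.+ 1ℚ) ℚ.* η      ≤⟨ ℚₚ.+-monoʳ-≤ (u ℚ.* v) (*-monoˡ-≤ (ℚₚ.<⇒≤ K>0) η≤δ) ⟩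
      u ℚ.* v ℚ.+ (A ℚ.+ B ℚ.+ 1ℚ) ℚ.* δ      ≡⟨ cong (u ℚ.* v ℚ.+_) Kδ≡ε ⟩
      u ℚ.* v ℚ.+ ε ∎

  -- Adds a (M - T) ≥ 0 and (1 - a)(M - V) ≥ 0. A randomised decision never beats the better pure
  -- one, and no comparison of reals has to be decided.
  mix-≤ : ∀ {a V T M} → 0ℝ ≤ a → a ≤ 1ℝ → T ℚ.≤ M → V ≤ fromℚ M →
    a * fromℚ T + (1ℝ - a) * V ≤ fromℚ M
  mix-≤ {a} {V} {T} {M} 0≤a a≤1 T≤M V≤M = mk≤ λ ε ε>0 →
    let (N₁ , p) = x≤y+ε (*-nonNeg 0≤a (fromℚ-nonNeg (0≤q-p T≤M))) (½ ℚ.* ε) (½>0 ε>0)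
        (N₂ , q) = x≤y+ε (*-nonNeg (≤⇒0≤- a≤1) (≤⇒0≤- V≤M)) (½ ℚ.* ε) (½>0 ε>0)
    in N₁ ℕ.⊔ N₂ , λ n n≥ → ≤-slack _
      (0≤+ (p n (ℕₚ.m⊔n≤o⇒m≤o N₁ N₂ n≥)) (q n (ℕₚ.m⊔n≤o⇒n≤o N₁ N₂ n≥)))
      (trans (solve 5 (λ a v t m h → (a :* t :+ (con 1ℚ :- a) :* v)
                 :+ ((a :* (m :- t) :+ h) :+ ((con 1ℚ :- a) :* (m :- v) :+ h)) := m :+ (h :+ h))
               refl (seq a n) (seq V n) T M (½ ℚ.* ε))
             (cong (M ℚ.+_) (½+½ ε)))

  sumℝ-≤ : ∀ {A : Set} {f : A → ℝ} {g : A → ℚ} {xs} →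
    All (λ x → f x ≤ fromℚ (g x)) xs → sumℝ (map f xs) ≤ fromℚ (∑ g xs)
  sumℝ-≤ [] = fromℚ-nonNeg ℚₚ.≤-refl
  sumℝ-≤ {f = f} {g} {x ∷ xs} (h ∷ hs) = mk≤ λ ε ε>0 →
    let (N₁ , p) = x≤y+ε h (½ ℚ.* ε) (½>0 ε>0)
        (N₂ , q) = x≤y+ε (sumℝ-≤ hs) (½ ℚ.* ε) (½>0 ε>0)
    in N₁ ℕ.⊔ N₂ , λ n n≥ → ℚₚ.≤-trans
      (ℚₚ.+-mono-≤ (p n (ℕₚ.m⊔n≤o⇒m≤o N₁ N₂ n≥)) (q n (ℕₚ.m⊔n≤o⇒n≤o N₁ N₂ n≥)))
      (ℚₚ.≤-reflexive (trans
        (solve 3 (λ a b h → (a :+ h) :+ (b :+ h) := (a :+ b) :+ (h :+ h)) refl (g x) (∑ g xs) (½ ℚ.* ε))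
        (cong ((g x ℚ.+ ∑ g xs) ℚ.+_) (½+½ ε))))

  seq-sumℝ : ∀ {A : Set} (f : A → ℝ) xs k → seq (sumℝ (map f xs)) k ≡ ∑ (λ x → seq (f x) k) xs
  seq-sumℝ f []       k = refl
  seq-sumℝ f (x ∷ xs) k = cong (seq (f x) k ℚ.+_) (seq-sumℝ f xs k)

  scale-≤ : ∀ {x y c q} → 0ℚ ℚ.≤ c → (∀ k → seq y k ≡ c ℚ.* seq x k) → x ≤ fromℚ q → y ≤ fromℚ (c ℚ.* q)
  scale-≤ {x} {y} {c} {q} 0≤c y≡cx x≤q = mk≤ λ ε ε>0 →
    -- 1 + c is positive even when c = 0.
    let (δ , δ>0 , eq) = divide {1ℚ ℚ.+ c} (ℚₚ.+-mono-<-≤ (ℚₚ.positive⁻¹ 1ℚ) 0≤c) ε>0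
        (N , h) = x≤y+ε x≤q δ δ>0
    in N , λ n n≥ → begin
      seq y n                            ≡⟨ y≡cx n ⟩
      c ℚ.* seq x n                      ≤⟨ *-monoˡ-≤ 0≤c (h n n≥) ⟩
      c ℚ.* (q ℚ.+ δ)                    ≤⟨ ≤-slack δ (ℚₚ.<⇒≤ δ>0) refl ⟩
      c ℚ.* (q ℚ.+ δ) ℚ.+ δ              ≡⟨ solve 3 (λ c q d → c :* (q :+ d) :+ d := c :* q :+ (con 1ℚ :+ c) :* d) refl c q δ ⟩
      c ℚ.* q ℚ.+ (1ℚ ℚ.+ c) ℚ.* δ       ≡⟨ cong (c ℚ.* q ℚ.+_) eq ⟩
      c ℚ.* q ℚ.+ ε ∎
    where open ≤-Reasoning

open RealBounds

-- Backward induction over the game tree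

module Game (ρ : ℝ) (A : Algorithm) where
  open +-*-Solver

  a : List ℕ → ℝ
  a p = accept A (map (ρ ^_) p)

  -- The unnormalised success weight still to come when p, with maximum m, has
  -- been rejected and r elements of xs are to follow.
  value : (n r : ℕ) (p : List ℕ) (m : ℕ) → List ℕ → ℝ
  value n zero    p m xs = 0ℝ
  value n (suc r) p m xs = sumℝ (map
    (λ (y , ys) → a (p ∷ʳ y) * fromℚ (winWeight n r (m ℕ.⊔ y) y ys)
                + (1ℝ - a (p ∷ʳ y)) * value n r (p ∷ʳ y) (m ℕ.⊔ y) ys)
    (picks xs))

  -- The k-th approximation of `winFrom`, where the instance enters only through its maximum M; this
  -- can then be read off the arrangement.
  winAt : (k M : ℕ) (p π : List ℕ) → ℚ
  winAt k M p []      = 0ℚ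
  winAt k M p (y ∷ π) = seq (a (p ∷ʳ y)) k ℚ.* indicator M y
    ℚ.+ (1ℚ ℚ.- seq (a (p ∷ʳ y)) k) ℚ.* winAt k M (p ∷ʳ y) π

  seq-maxIndicator : ∀ S y k → seq (maxIndicator S y) k ≡ indicator (max S) y
  seq-maxIndicator S y k with all? (ℕₚ._≤? y) S | max S ℕₚ.≤? y
  ... | yes _   | yes _   = refl
  ... | no  _   | no  _   = refl
  ... | yes all | no  max≰ = contradiction (max-lub all) max≰
  ... | no  ¬all | yes max≤ = contradiction (All.map (λ h → ℕₚ.≤-trans h max≤) (≤max S)) ¬all

  seq-winFrom : ∀ S p π k → seq (winFrom ρ A S p π) k ≡ winAt k (max S) p π
  seq-winFrom S p []      k = refl
  seq-winFrom S p (y ∷ π) k = cong₂ ℚ._+_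
    (cong (seq (a (p ∷ʳ y)) k ℚ.*_) (seq-maxIndicator S y k))
    (cong ((1ℚ ℚ.- seq (a (p ∷ʳ y)) k) ℚ.*_) (seq-winFrom S (p ∷ʳ y) π k))

  -- Acceptance probabilities depend on the prefix alone, so they factor out of the sums over
  -- continuations.
  seq-value : ∀ n r p m xs k → seq (value n r p m xs) k ≡
    ∑arrangements r xs (λ π → R n (suc (m ℕ.⊔ max π)) ℚ.* winAt k (m ℕ.⊔ max π) p π)
  seq-value n zero    p m xs k = sym (ℚₚ.*-zeroʳ (R n (suc (m ℕ.⊔ 0))))
  seq-value n (suc r) p m xs k = trans (seq-sumℝ _ (picks xs) k) (∑-cong (λ (y , ys) → term y ys) (picks xs))
    where
    open ≤-Reasoning
    term : ∀ y ys → let α = seq (a (p ∷ʳ y)) k in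
      α ℚ.* winWeight n r (m ℕ.⊔ y) y ys ℚ.+ (1ℚ ℚ.- α) ℚ.* seq (value n r (p ∷ʳ y) (m ℕ.⊔ y) ys) k ≡
      ∑arrangements r ys (λ π → R n (suc (m ℕ.⊔ (y ℕ.⊔ max π))) ℚ.* winAt k (m ℕ.⊔ (y ℕ.⊔ max π)) p (y ∷ π))
    term y ys = begin-equality
      α ℚ.* winWeight n r (m ℕ.⊔ y) y ys ℚ.+ β ℚ.* seq (value n r (p ∷ʳ y) (m ℕ.⊔ y) ys) k
        ≡⟨ cong (λ v → α ℚ.* winWeight n r (m ℕ.⊔ y) y ys ℚ.+ β ℚ.* v) (seq-value n r (p ∷ʳ y) (m ℕ.⊔ y) ys k) ⟩
      α ℚ.* ∑arrangements r ys F ℚ.+ β ℚ.* ∑arrangements r ys G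
        ≡⟨ cong₂ ℚ._+_ (sym (∑arr-*ˡ r ys α F)) (sym (∑arr-*ˡ r ys β G)) ⟩
      ∑arrangements r ys (λ π → α ℚ.* F π) ℚ.+ ∑arrangements r ys (λ π → β ℚ.* G π)
        ≡⟨ sym (∑arr-+ r ys (λ π → α ℚ.* F π) (λ π → β ℚ.* G π)) ⟩
      ∑arrangements r ys (λ π → α ℚ.* F π ℚ.+ β ℚ.* G π)
        ≡⟨ ∑arr-cong r ys (λ π → trans
             (solve 5 (λ α β w i v → α :* (w :* i) :+ β :* (w :* v) := w :* (α :* i :+ β :* v)) refl
               α β (R n (suc (m ℕ.⊔ y ℕ.⊔ max π))) (indicator (m ℕ.⊔ y ℕ.⊔ max π) y) (winAt k (m ℕ.⊔ y ℕ.⊔ max π) (p ∷ʳ y) π))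
             (cong (λ M → R n (suc M) ℚ.* winAt k M p (y ∷ π)) (ℕₚ.⊔-assoc m y (max π)))) ⟩
      ∑arrangements r ys (λ π → R n (suc (m ℕ.⊔ (y ℕ.⊔ max π))) ℚ.* winAt k (m ℕ.⊔ (y ℕ.⊔ max π)) p (y ∷ π)) ∎
      where
      α β : ℚ
      α = seq (a (p ∷ʳ y)) k
      β = 1ℚ ℚ.- α
      F G : List ℕ → ℚ
      F π = R n (suc (m ℕ.⊔ y ℕ.⊔ max π)) ℚ.* indicator (m ℕ.⊔ y ℕ.⊔ max π) y
      G π = R n (suc (m ℕ.⊔ y ℕ.⊔ max π)) ℚ.* winAt k (m ℕ.⊔ y ℕ.⊔ max π) (p ∷ʳ y) π

  -- After an arrival below m only continuing has value, with coefficient φ; a record offers the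
  -- better of 1 and φ. Summed by `R-shrink` and `∑-R-tail`, the two cases give the two terms of the
  -- recursion for `optimum`.
  value-bound : ∀ {H j p m xs} r → Seen H (suc j) p m xs →
    value (suc j ℕ.+ r) r p m xs ≤ fromℚ (optimum (suc j) r ℚ.* R (suc j) (suc m))
  value-bound {j = j} {m = m} zero s = ≤-fromℚ (fromℚ-nonNeg ℚₚ.≤-refl)
    (ℚₚ.≤-reflexive (sym (ℚₚ.*-zeroˡ (R (suc j) (suc m)))))
  value-bound {H} {j} {p} {m} {xs} (suc r) s =
    ≤-fromℚ (sumℝ-≤ (All.map (λ {(y , ys)} → term y ys) (picks-↭ xs))) (begin
      ∑ (λ (y , _) → f y) (picks xs)
        ≡⟨ ∑-picks f xs ⟩
      ∑ f xs
        ≡⟨ ∑-stepAt-remaining s C B ⟩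
      ι (suc m ∸ i) ℚ.* (φ ℚ.* R (suc i) (suc m)) ℚ.+ ∑ (λ t → M ℚ.* R (suc i) (suc (t ℕ.+ suc m))) (downFrom (H ∸ suc m))
        ≡⟨ cong₂ ℚ._+_
             (solve 3 (λ k f r → k :* (f :* r) := f :* (k :* r)) refl (ι (suc m ∸ i)) φ (R (suc i) (suc m)))
             (∑-*ˡ M (λ t → R (suc i) (suc (t ℕ.+ suc m))) (downFrom (H ∸ suc m))) ⟩
      φ ℚ.* (ι (suc m ∸ i) ℚ.* R (suc i) (suc m)) ℚ.+ M ℚ.* ∑ (λ t → R (suc i) (suc (t ℕ.+ suc m))) (downFrom (H ∸ suc m))
        ≤⟨ ℚₚ.+-mono-≤ (*-monoˡ-≤ φ≥0 (R-shrink i (suc m))) (*-monoˡ-≤ (0≤1⊔ φ) (∑-R-tail (seen≤ s) (H ∸ suc m))) ⟩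
      φ ℚ.* R i (suc m) ℚ.+ M ℚ.* (⅟ i ℚ.* R i (suc m))
        ≡⟨ solve 4 (λ f m u r → f :* r :+ m :* (u :* r) := (f :+ u :* m) :* r) refl φ M (⅟ i) (R i (suc m)) ⟩
      optimum i (suc r) ℚ.* R i (suc m) ∎)
    where
    open ≤-Reasoning
    i n : ℕ
    i = suc j
    n = i ℕ.+ suc r
    φ M C : ℚ
    φ = optimum (suc i) r
    M = 1ℚ ℚ.⊔ φ
    C = φ ℚ.* R (suc i) (suc m)
    B f : ℕ → ℚ
    B y = M ℚ.* R (suc i) (suc y)
    f = stepAt m C B
    φ≥0 : 0ℚ ℚ.≤ φ
    φ≥0 = optimum≥0 (suc i) r
    mix : ∀ {y ys M′ q} → M′ ≡ m ℕ.⊔ y → winWeight n r M′ y ys ℚ.≤ q → value (suc i ℕ.+ r) r (p ∷ʳ y) M′ ys ≤ fromℚ q →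
      q ≡ f y →
      a (p ∷ʳ y) * fromℚ (winWeight n r (m ℕ.⊔ y) y ys) + (1ℝ - a (p ∷ʳ y)) * value n r (p ∷ʳ y) (m ℕ.⊔ y) ys ≤ fromℚ (f y)
    mix {y} {ys} refl T≤ V≤ refl = mix-≤ (accept≥0 A _) (accept≤1 A _) T≤
      (subst (λ N → value N r (p ∷ʳ y) (m ℕ.⊔ y) ys ≤ fromℚ (f y)) (sym (ℕₚ.+-suc i r)) V≤)
    term : ∀ y ys → y ∷ ys ↭ xs →
      a (p ∷ʳ y) * fromℚ (winWeight n r (m ℕ.⊔ y) y ys) + (1ℝ - a (p ∷ʳ y)) * value n r (p ∷ʳ y) (m ℕ.⊔ y) ys ≤ fromℚ (f y)
    term y ys y∷ys↭xs with ℕₚ.≤-<-connex y m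
    ... | inj₁ y≤m = mix (sym (ℕₚ.m≥n⇒m⊔n≡m y≤m))
      -- Distinctness excludes y = m, so accepting y cannot win.
      (ℚₚ.≤-trans (ℚₚ.≤-reflexive (winWeight-lost n r ys (ℕₚ.≤∧≢⇒< y≤m (next≢m s y∷ys↭xs))))
        (0≤* φ≥0 (R≥0 (suc i) (suc m))))
      (value-bound r (see-lower s y∷ys↭xs y≤m))
      (sym (stepAt-≤ B y≤m))
    ... | inj₂ m<y = mix (sym (ℕₚ.m≤n⇒m⊔n≡n (ℕₚ.<⇒≤ m<y)))
      (begin
        winWeight n r y y ys                  ≡⟨ cong (λ N → winWeight N r y y ys) (ℕₚ.+-suc i r) ⟩
        winWeight (suc i ℕ.+ r) r y y ys      ≤⟨ winWeight-bound r s′ ⟩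
        R (suc i) (suc y)                     ≡⟨ sym (ℚₚ.*-identityˡ _) ⟩
        1ℚ ℚ.* R (suc i) (suc y)              ≤⟨ *-monoʳ-≤ (R≥0 (suc i) (suc y)) (ℚₚ.p≤p⊔q 1ℚ φ) ⟩
        B y ∎)
      (≤-fromℚ (value-bound r s′) (*-monoʳ-≤ (R≥0 (suc i) (suc y)) (ℚₚ.p≤q⊔p 1ℚ φ)))
      (sym (stepAt-> B m<y))
      where
      s′ = see-record s y∷ys↭xs (ℕₚ.<⇒≤ m<y)

  -- Before the first arrival there is no maximum to telescope from, so the record weights 1 / (y +
  -- 1) add up to `harmonic H`. The 0 is a neutral placeholder, as 0 ⊔ y = y.
  value-start : ∀ r H → value (suc r) (suc r) [] 0 (downFrom H) ≤
    fromℚ ((1ℚ ℚ.⊔ optimum 1 r) ℚ.* harmonic H)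
  value-start r H = ≤-fromℚ (sumℝ-≤ (All.map (λ {(y , ys)} → term y ys) (picks-↭ (downFrom H))))
    (ℚₚ.≤-reflexive (trans (∑-picks (λ y → M ℚ.* R 1 (suc y)) (downFrom H))
      (trans (∑-*ˡ M (λ y → R 1 (suc y)) (downFrom H)) (cong (M ℚ.*_) (∑-R₁ H)))))
    where
    M : ℚ
    M = 1ℚ ℚ.⊔ optimum 1 r
    ∑-R₁ : ∀ H → ∑ (λ y → R 1 (suc y)) (downFrom H) ≡ harmonic H
    ∑-R₁ zero    = refl
    ∑-R₁ (suc H) = cong₂ ℚ._+_ (ℚₚ.*-identityʳ (⅟ (suc H))) (∑-R₁ H)
    term : ∀ y ys → y ∷ ys ↭ downFrom H →
      a [ y ] * fromℚ (winWeight (suc r) r y y ys) + (1ℝ - a [ y ]) * value (suc r) r [ y ] y ys ≤ fromℚ (M ℚ.* R 1 (suc y))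
    term y ys p = mix-≤ (accept≥0 A _) (accept≤1 A _)
      (ℚₚ.≤-trans (winWeight-bound r (see-first p))
        (subst (ℚ._≤ M ℚ.* R 1 (suc y)) (ℚₚ.*-identityˡ (R 1 (suc y))) (*-monoʳ-≤ (R≥0 1 (suc y)) (ℚₚ.p≤p⊔q 1ℚ (optimum 1 r)))))
      (≤-fromℚ (value-bound r (see-first p)) (*-monoʳ-≤ (R≥0 1 (suc y)) (ℚₚ.p≤q⊔p 1ℚ (optimum 1 r))))

-- The prior as a distribution, and its success probability

module Prior (n H : ℕ) (c : ℚ) (0≤c : 0ℚ ℚ.≤ c) (normalised : totalWeight n H ℚ.* c ≡ 1ℚ) where
  open +-*-Solver

  exponents : FiniteExponentSet
  exponents = record { elements = downFrom H ; unique = downFrom⁺ H }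

  prior : Distribution n exponents
  prior = record
    { weight   = λ S → fromℚ (c ℚ.* R n (suc (max S)))
    ; weight≥0 = λ {S} _ → fromℚ-nonNeg (0≤* 0≤c (R≥0 n (suc (max S))))
    ; total    = mk≈ λ ε ε>0 → 0 , λ k _ → subst (λ q → ℚ.∣ q ℚ.- 1ℚ ∣ ℚ.< ε) (sym (sums-to-1 k)) ε>0
    }
    where
    sums-to-1 : ∀ k → seq (sumℝ (map (λ S → fromℚ (c ℚ.* R n (suc (max S)))) (choose n (downFrom H)))) k ≡ 1ℚ
    sums-to-1 k = trans (seq-sumℝ _ (choose n (downFrom H)) k)
      (trans (∑-*ˡ c (λ S → R n (suc (max S))) (choose n (downFrom H)))
        (trans (ℚₚ.*-comm c (totalWeight n H)) normalised))

  module _ (ρ : ℝ) (A : Algorithm) where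
    open Game ρ A

    -- A permutation of S has the maximum of S, so the weight can be attached to the arrangement;
    -- after that the instance is summed out.
    seq-success : ∀ k → seq (successProbability ρ n exponents prior A) k ≡
      (c ℚ.* 1/ n !) ℚ.* seq (value n n [] 0 (downFrom H)) k
    seq-success k = begin-equality
      seq (successProbability ρ n exponents prior A) k
        ≡⟨ seq-sumℝ _ (choose n (downFrom H)) k ⟩
      ∑ (λ S → (c ℚ.* R n (suc (max S))) ℚ.* (1/ n ! ℚ.* seq (sumℝ (map (winFrom ρ A S []) (permutations S))) k)) (choose n (downFrom H))
        ≡⟨ ∑-cong inner (choose n (downFrom H)) ⟩
      ∑ (λ S → (c ℚ.* 1/ n !) ℚ.* ∑ F (permutations S)) (choose n (downFrom H))
        ≡⟨ ∑-*ˡ (c ℚ.* 1/ n !) (λ S → ∑ F (permutations S)) (choose n (downFrom H)) ⟩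
      (c ℚ.* 1/ n !) ℚ.* ∑ (λ S → ∑ F (permutations S)) (choose n (downFrom H))
        ≡⟨ cong ((c ℚ.* 1/ n !) ℚ.*_) (trans (∑-choose-permutations n (downFrom H) F) (sym (seq-value n n [] 0 (downFrom H) k))) ⟩
      (c ℚ.* 1/ n !) ℚ.* seq (value n n [] 0 (downFrom H)) k ∎
      where
      open ≤-Reasoning
      F : List ℕ → ℚ
      F π = R n (suc (max π)) ℚ.* winAt k (max π) [] π
      inner : ∀ S → (c ℚ.* R n (suc (max S))) ℚ.* (1/ n ! ℚ.* seq (sumℝ (map (winFrom ρ A S []) (permutations S))) k) ≡
        (c ℚ.* 1/ n !) ℚ.* ∑ F (permutations S)
      inner S = begin-equality
        (c ℚ.* w) ℚ.* (1/ n ! ℚ.* seq (sumℝ (map (winFrom ρ A S []) (permutations S))) k)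
          ≡⟨ cong (λ s → (c ℚ.* w) ℚ.* (1/ n ! ℚ.* s)) (trans (seq-sumℝ (winFrom ρ A S []) (permutations S) k)
               (∑-cong (λ π → seq-winFrom S [] π k) (permutations S))) ⟩
        (c ℚ.* w) ℚ.* (1/ n ! ℚ.* s)
          ≡⟨ solve 4 (λ c w u s → (c :* w) :* (u :* s) := (c :* u) :* (w :* s)) refl c w (1/ n !) s ⟩
        (c ℚ.* 1/ n !) ℚ.* (w ℚ.* s)
          ≡⟨ cong ((c ℚ.* 1/ n !) ℚ.*_) (trans (sym (∑-*ˡ w (winAt k (max S) []) (permutations S)))
               (∑-congAll (All.map (λ {π} p → cong (λ M → R n (suc M) ℚ.* winAt k M [] π) (sym (max-↭ p))) (permutations-↭ S)))) ⟩
        (c ℚ.* 1/ n !) ℚ.* ∑ F (permutations S) ∎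
        where
        w s : ℚ
        w = R n (suc (max S))
        s = ∑ (winAt k (max S) []) (permutations S)

success-bound : ∀ r H c (0≤c : 0ℚ ℚ.≤ c) (normalised : totalWeight (suc r) H ℚ.* c ≡ 1ℚ) ρ A →
  let open Prior (suc r) H c 0≤c normalised in
  successProbability ρ (suc r) exponents prior A ≤
    fromℚ ((c ℚ.* 1/ suc r !) ℚ.* ((1ℚ ℚ.⊔ optimum 1 r) ℚ.* harmonic H))
success-bound r H c 0≤c normalised ρ A = scale-≤
  (0≤* 0≤c (ℚₚ.nonNegative⁻¹ _ {{ExpSumLemmas.fact-nonNeg (suc r)}}))
  (Prior.seq-success (suc r) H c 0≤c normalised ρ A)
  (Game.value-start ρ A r H)

-- Choice of n and H for a given error

module Parameters {γ : ℚ} (γ>0 : 0ℚ ℚ.< γ) where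
  open +-*-Solver
  open ArithmeticLemmas using (divide)
  open ExpSumLemmas using (archimedean; unit-antitone; unit-pos)

  private
    -- 5 = 2 + 3: the additive error 2 / n is at most 2 η, and the factor 1 + η acts on a quantity
    -- of at most 3.
    γ/5 = divide {ι 5} (ℚₚ.positive⁻¹ (ι 5)) γ>0
    η : ℚ
    η = proj₁ γ/5
    η>0 : 0ℚ ℚ.< η
    η>0 = proj₁ (proj₂ γ/5)
    fine = archimedean η η>0

  r : ℕ
  r = suc (proj₁ fine)

  private
    h : ℚ
    h = harmonic r
    h>0 : 0ℚ ℚ.< h
    h>0 = ℚₚ.+-mono-<-≤ (ℚₚ.positive⁻¹ (⅟ r) {{unit-pos r}}) (harmonic≥0 (proj₁ fine))
    -- Once Y is at least B = h / η, the normalisation loss h is at most η Y.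
    h/η = divide η>0 h>0
    B : ℚ
    B = proj₁ h/η
    B>0 : 0ℚ ℚ.< B
    B>0 = proj₁ (proj₂ h/η)
    long = harmonic-unbounded B>0 (proj₁ fine)

  H : ℕ
  H = proj₁ long ℕ.+ r

  private
    Y : ℚ
    Y = fac r ℚ.* totalWeight (suc r) H
    H≤Y+h : harmonic H ℚ.≤ Y ℚ.+ h
    H≤Y+h = totalWeight-bound r (proj₁ long)
    B≤Y : B ℚ.≤ Y
    B≤Y = begin
      B                       ≡⟨ solve 2 (λ b h → b := b :+ h :- h) refl B h ⟩
      B ℚ.+ h ℚ.- h           ≤⟨ ℚₚ.+-monoˡ-≤ (ℚ.- h) (ℚₚ.≤-trans (proj₂ long) H≤Y+h) ⟩
      Y ℚ.+ h ℚ.- h           ≡⟨ solve 2 (λ b h → b :+ h :- h := b) refl Y h ⟩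
      Y ∎
      where open ≤-Reasoning
    1/Y = divide {Y} (ℚₚ.<-≤-trans B>0 B≤Y) (ℚₚ.positive⁻¹ 1ℚ)
    Y⁻¹ : ℚ
    Y⁻¹ = proj₁ 1/Y
    Y⁻¹≥0 : 0ℚ ℚ.≤ Y⁻¹
    Y⁻¹≥0 = ℚₚ.<⇒≤ (proj₁ (proj₂ 1/Y))

  c : ℚ
  c = fac r ℚ.* Y⁻¹

  0≤c : 0ℚ ℚ.≤ c
  0≤c = 0≤* (fac≥0 r) Y⁻¹≥0

  normalised : totalWeight (suc r) H ℚ.* c ≡ 1ℚ
  normalised = trans
    (solve 3 (λ z f y → z :* (f :* y) := (f :* z) :* y) refl (totalWeight (suc r) H) (fac r) Y⁻¹)
    (proj₂ (proj₂ 1/Y))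

  private
    M u : ℚ
    M = 1ℚ ℚ.⊔ optimum 1 r
    u = ⅟ (suc r)

    bound≤ : (c ℚ.* 1/ suc r !) ℚ.* (M ℚ.* harmonic H) ℚ.≤ (u ℚ.* M) ℚ.* (1ℚ ℚ.+ η)
    bound≤ = begin
      (c ℚ.* 1/ suc r !) ℚ.* (M ℚ.* harmonic H)
        ≡⟨ cong (λ x → (c ℚ.* x) ℚ.* (M ℚ.* harmonic H)) (ExpSumLemmas.fact-step r) ⟩
      ((fac r ℚ.* Y⁻¹) ℚ.* (u ℚ.* 1/ r !)) ℚ.* (M ℚ.* harmonic H)
        ≡⟨ solve 6 (λ f y u g m k → ((f :* y) :* (u :* g)) :* (m :* k) := (f :* g) :* ((u :* m) :* (y :* k))) refl
             (fac r) Y⁻¹ u (1/ r !) M (harmonic H) ⟩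
      (fac r ℚ.* 1/ r !) ℚ.* ((u ℚ.* M) ℚ.* (Y⁻¹ ℚ.* harmonic H))
        ≡⟨ trans (cong (ℚ._* ((u ℚ.* M) ℚ.* (Y⁻¹ ℚ.* harmonic H))) (fac*1/! r)) (ℚₚ.*-identityˡ _) ⟩
      (u ℚ.* M) ℚ.* (Y⁻¹ ℚ.* harmonic H)
        ≤⟨ *-monoˡ-≤ uM≥0 (*-monoˡ-≤ Y⁻¹≥0 H≤Y[1+η]) ⟩
      (u ℚ.* M) ℚ.* (Y⁻¹ ℚ.* (Y ℚ.* (1ℚ ℚ.+ η)))
        ≡⟨ solve 4 (λ x y z e → x :* (y :* (z :* e)) := x :* ((z :* y) :* e)) refl (u ℚ.* M) Y⁻¹ Y (1ℚ ℚ.+ η) ⟩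
      (u ℚ.* M) ℚ.* ((Y ℚ.* Y⁻¹) ℚ.* (1ℚ ℚ.+ η))
        ≡⟨ cong ((u ℚ.* M) ℚ.*_) (trans (cong (ℚ._* (1ℚ ℚ.+ η)) (proj₂ (proj₂ 1/Y))) (ℚₚ.*-identityˡ _)) ⟩
      (u ℚ.* M) ℚ.* (1ℚ ℚ.+ η) ∎
      where
      open ≤-Reasoning
      uM≥0 : 0ℚ ℚ.≤ u ℚ.* M
      uM≥0 = 0≤* (⅟≥0 (suc r)) (0≤1⊔ (optimum 1 r))
      H≤Y[1+η] : harmonic H ℚ.≤ Y ℚ.* (1ℚ ℚ.+ η)
      H≤Y[1+η] = begin
        harmonic H            ≤⟨ H≤Y+h ⟩
        Y ℚ.+ h               ≡⟨ cong (Y ℚ.+_) (sym (proj₂ (proj₂ h/η))) ⟩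
        Y ℚ.+ η ℚ.* B         ≤⟨ ℚₚ.+-monoʳ-≤ Y (*-monoˡ-≤ (ℚₚ.<⇒≤ η>0) B≤Y) ⟩
        Y ℚ.+ η ℚ.* Y         ≡⟨ solve 2 (λ y e → y :+ e :* y := y :* (con 1ℚ :+ e)) refl Y η ⟩
        Y ℚ.* (1ℚ ℚ.+ η) ∎

  bound : ∀ N (1≤E : 1ℚ ℚ.≤ expSum N) →
    (c ℚ.* 1/ suc r !) ℚ.* (M ℚ.* harmonic H) ℚ.≤ inv (expSum N) 1≤E ℚ.+ γ
  bound N 1≤E = begin
    (c ℚ.* 1/ suc r !) ℚ.* (M ℚ.* harmonic H)
      ≤⟨ bound≤ ⟩
    (u ℚ.* M) ℚ.* (1ℚ ℚ.+ η)
      ≡⟨ solve 2 (λ x e → x :* (con 1ℚ :+ e) := x :+ e :* x) refl (u ℚ.* M) η ⟩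
    u ℚ.* M ℚ.+ η ℚ.* (u ℚ.* M)
      ≤⟨ ℚₚ.+-mono-≤ uM≤ (*-monoˡ-≤ (ℚₚ.<⇒≤ η>0) (ℚₚ.≤-trans uM≤ (ℚₚ.+-mono-≤ (*-monoˡ-≤ (ι≥0 2) (unit-antitone {0} {r} ℕ.z≤n)) (InverseLemmas.inv≤1 (expSum N) 1≤E)))) ⟩
    (ι 2 ℚ.* u ℚ.+ I) ℚ.+ η ℚ.* (ι 2 ℚ.* 1ℚ ℚ.+ 1ℚ)
      ≤⟨ ℚₚ.+-monoˡ-≤ (η ℚ.* (ι 2 ℚ.* 1ℚ ℚ.+ 1ℚ)) (ℚₚ.+-monoˡ-≤ I (*-monoˡ-≤ (ι≥0 2) u≤η)) ⟩
    (ι 2 ℚ.* η ℚ.+ I) ℚ.+ η ℚ.* (ι 2 ℚ.* 1ℚ ℚ.+ 1ℚ)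
      ≡⟨ solve 2 (λ e i → (con (ι 2) :* e :+ i) :+ e :* (con (ι 2) :* con 1ℚ :+ con 1ℚ) := i :+ con (ι 5) :* e) refl η I ⟩
    I ℚ.+ ι 5 ℚ.* η
      ≡⟨ cong (I ℚ.+_) (proj₂ (proj₂ γ/5)) ⟩
    I ℚ.+ γ ∎
    where
    open ≤-Reasoning
    I : ℚ
    I = inv (expSum N) 1≤E
    u≤η : u ℚ.≤ η
    u≤η = ℚₚ.≤-trans (unit-antitone (ℕₚ.n≤1+n (proj₁ fine))) (ℚₚ.<⇒≤ (proj₂ fine))
    uM≤ : u ℚ.* M ℚ.≤ ι 2 ℚ.* u ℚ.+ I
    uM≤ = begin
      u ℚ.* M                               ≤⟨ *-monoˡ-≤ (⅟≥0 (suc r)) (1⊔optimum-bound N 1≤E r) ⟩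
      u ℚ.* (ι 2 ℚ.+ ι r ℚ.* I)             ≤⟨ *-monoˡ-≤ (⅟≥0 (suc r)) (ℚₚ.+-monoʳ-≤ (ι 2) (*-monoʳ-≤ (inv≥0 (expSum N) 1≤E) (ι-mono (ℕₚ.n≤1+n r)))) ⟩
      u ℚ.* (ι 2 ℚ.+ ι (suc r) ℚ.* I)       ≡⟨ solve 4 (λ u t n i → u :* (t :+ n :* i) := t :* u :+ n :* (u :* i)) refl u (ι 2) (ι (suc r)) I ⟩
      ι 2 ℚ.* u ℚ.+ ι (suc r) ℚ.* (u ℚ.* I) ≡⟨ cong (ι 2 ℚ.* u ℚ.+_) (ι*⅟-cancelˡ r I) ⟩
      ι 2 ℚ.* u ℚ.+ I ∎

theorem5p6 : (ε ρ : ℝ) → 0ℝ < ε → 1ℝ < ρ →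
    Σ[ n ∈ ℕ ] Σ[ W ∈ FiniteExponentSet ] Σ[ D ∈ Distribution n W ]
    (1 ℕ.≤ n × ((A : Algorithm) → successProbability ρ n W D A ≤ 1/e + ε))
theorem5p6 ε ρ (mk< γ γ>0 (N₀ , γ≤ε)) _ =
  suc r , exponents , prior , ℕ.s≤s ℕ.z≤n , λ A → mk≤ λ δ δ>0 →
    let (N , h) = x≤y+ε (success-bound r H c 0≤c normalised ρ A) δ δ>0 in
    N₀ ℕ.⊔ N , λ k k≥ → ℚₚ.≤-trans (h k (ℕₚ.m⊔n≤o⇒n≤o N₀ N k≥)) (ℚₚ.+-monoˡ-≤ δ
      -- The index k doubles as the truncation degree: the k-th approximation of `1/e` is the
      -- reciprocal of `expSum k`.
      (ℚₚ.≤-trans (bound k (ExpSumLemmas.expSum-mono {0} {k} (ℕₚ.≤⇒≤′ ℕ.z≤n)))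
        (ℚₚ.+-monoʳ-≤ (seq 1/e k)
          (subst (ℚ._≤ seq ε k) (ℚₚ.+-identityˡ γ) (γ≤ε k (ℕₚ.m⊔n≤o⇒m≤o N₀ N k≥))))))
  where
  open Parameters γ>0
  open Prior (suc r) H c 0≤c normalised
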